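{- Let $\mathcal{M}$ be a regular matroid of rank $r>0$ on $n$ elements, and let $M_1, M_2 \in \mathbb{R}^{r\times n}$ be two full-rank weakly unimodular matrices, each representing $\mathcal{M}$. Then there exists $F \in \mathrm{GL}_r(\mathbb{Z})$ such that \[\mathcal{P}_{M_2} = \psi_F(\mathcal{P}_{M_1}) \quad\text{and}\quad \mathcal{P}_{M_2}^{\Delta} = \psi_{(F^T)^{ -1}}(\mathcal{P}_{M_1}^{\Delta}).\]
   Context: A matrix $M\in\mathbb{R}^{r\times n}$ with $0<r\le n$ is called full-rank weakly unimodular if it has rank $r$ and every $r\times r$ minor of $M$ lies in $\{0,1,-1\}$ (such a matrix with rank $r$ necessarily has integer-valued relevant structure; in the paper these matrices are integer matrices). A matrix $M$ represents a matroid $\mathcal{M}$ if the matroid on the column index set $[n]$, in which a set of indices is independent iff the corresponding columns are linearly independent, is isomorphic to $\mathcal{M}$. A matroid of positive rank is regular if it can be represented by a full-rank weakly unimodular matrix (equivalently, by a totally unimodular matrix). For a matrix $M$ with $r$ rows, $\mathcal{P}_M \subseteq \mathbb{R}^r$ denotes the polytope $\mathrm{conv}$ of the columns of the $r\times 2n$ matrix $[M\mid -M]$. For $F\in \mathrm{GL}_r(\mathbb{Z})$, $\psi_F:\mathbb{R}^r\to\mathbb{R}^r$ is the linear map $\mathbf{x}\mapsto F\mathbf{x}$. For a full-dimensional polytope $P\subseteq\mathbb{R}^r$ with the origin in its interior, the polar is $P^{\Delta}=\{\mathbf{u}\in\mathbb{R}^r : \mathbf{u}\cdot\mathbf{x}\le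 1 \text{ for all } \mathbf{x}\in P\}$.
   Formalization: The polytopes, their polars and the maps ψ_F are taken in ℚ^r instead of ℝ^r (rational points, rational convex coefficients), and linear independence is over ℚ; the matrices are integer matrices, as in the paper. -}

module Defs where

open import Data.Nat using (ℕ; zero; suc; _<_; _≤_)
open import Data.Fin using (Fin; zero; suc; punchIn; toℕ)
open import Data.Fin.Subset as Sub using (Subset; _∈_; _∉_; _⊆_; ∣_∣; ⁅_⁆; _∪_)
open import Data.Fin.Permutation using (Permutation′; _⟨$⟩ˡ_)
open import Data.Integer as ℤ using (ℤ; +_)
open import Data.Rational as ℚ using (ℚ; 0ℚ; 1ℚ)
open import Data.Product using (Σ; ∃; _×_; _,_)
open import Function.Bundles using (_⇔_)
open import Function.Definitions using (Injective)
open import Relation.Binary.PropositionalEquality using (_≡_)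
open import Relation.Nullary using (¬_)

sumℤ : ∀ {n} → (Fin n → ℤ) → ℤ
sumℤ {zero}  f = + 0
sumℤ {suc n} f = f zero ℤ.+ sumℤ (λ i → f (suc i))

sumℚ : ∀ {n} → (Fin n → ℚ) → ℚ
sumℚ {zero}  f = 0ℚ
sumℚ {suc n} f = f zero ℚ.+ sumℚ (λ i → f (suc i))

Mat : ℕ → ℕ → Set
Mat m n = Fin m → Fin n → ℤ

Vecℚ : ℕ → Set
Vecℚ r = Fin r → ℚ

toℚ : ℤ → ℚ
toℚ z = z ℚ./ 1

transpose : ∀ {m n} → Mat m n → Mat n m
transpose A i j = A j i

_·ᴹ_ : ∀ {m k n} → Mat m k → Mat k n → Mat m n
(A ·ᴹ B) i j = sumℤ (λ l → A i l ℤ.* B l j)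

identity : ∀ {r} → Mat r r
identity i j with i Data.Fin.≟ j
... | Relation.Nullary.yes _ = + 1
... | Relation.Nullary.no  _ = + 0

det : ∀ {k} → Mat k k → ℤ
det {zero}  A = + 1
det {suc k} A =
  sumℤ (λ j → ((ℤ.- (+ 1)) ℤ.^ toℕ j) ℤ.* (A zero j ℤ.*
              det (λ i l → A (suc i) (punchIn j l))))

combo : ∀ {r n} → Mat r n → (Fin n → ℚ) → Vecℚ r
combo M a i = sumℚ (λ j → a j ℚ.* toℚ (M i j))

apply : ∀ {r} → Mat r r → Vecℚ r → Vecℚ r
apply F x i = sumℚ (λ j → toℚ (F i j) ℚ.* x j)

dot : ∀ {r} → Vecℚ r → Vecℚ r → ℚ
dot u x = sumℚ (λ i → u i ℚ.* x i)

-- Linear independence (over ℚ; for integer matrices this agrees with ℝ)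

ColsIndep : ∀ {r n} → Mat r n → (Fin n → Set) → Set
ColsIndep {r} {n} M S =
  ∀ (a : Fin n → ℚ) → (∀ j → ¬ S j → a j ≡ 0ℚ) →
  (∀ i → combo M a i ≡ 0ℚ) → ∀ j → S j → a j ≡ 0ℚ

FullRowRank : ∀ {r n} → Mat r n → Set
FullRowRank {r} {n} M = ColsIndep (transpose M) (λ _ → Data.Unit.⊤)
  where import Data.Unit

FullRankWeaklyUnimodular : ∀ {r n} → Mat r n → Set
FullRankWeaklyUnimodular {r} {n} M =
  FullRowRank M ×
  (∀ (c : Fin r → Fin n) → Injective _≡_ _≡_ c →
     let d = det (λ i k → M i (c k)) in
     (d ≡ + 0) Data.Sum.⊎ ((d ≡ + 1) Data.Sum.⊎ (d ≡ ℤ.- (+ 1))))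
  where import Data.Sum

record Matroid (n : ℕ) : Set₁ where
  field
    Indep      : Subset n → Set
    indep-∅    : Indep Sub.⊥
    indep-⊆    : ∀ {A B} → A ⊆ B → Indep B → Indep A
    indep-aug  : ∀ {A B} → Indep A → Indep B → ∣ A ∣ < ∣ B ∣ →
                 ∃ λ x → x ∈ B × x ∉ A × Indep (⁅ x ⁆ ∪ A)

HasRank : ∀ {n} → Matroid n → ℕ → Set
HasRank {n} 𝓜 r =
  (∃ λ (S : Subset n) → Matroid.Indep 𝓜 S × ∣ S ∣ ≡ r) ×
  (∀ (S : Subset n) → Matroid.Indep 𝓜 S → ∣ S ∣ ≤ r)

-- M represents 𝓜: the column matroid of M is isomorphic to 𝓜, i.e. there
-- is a bijection σ from the ground set of 𝓜 to the column indices such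
-- that S is independent in 𝓜 iff the columns σ(S) are linearly independent.
Represents : ∀ {r n} → Mat r n → Matroid n → Set
Represents {r} {n} M 𝓜 =
  Σ (Permutation′ n) λ σ →
    ∀ (S : Subset n) →
      Matroid.Indep 𝓜 S ⇔ ColsIndep M (λ j → (σ ⟨$⟩ˡ j) ∈ S)

Regular : ∀ {n} → Matroid n → ℕ → Set
Regular {n} 𝓜 r = Σ (Mat r n) λ M → FullRankWeaklyUnimodular M × Represents M 𝓜

IsInverse : ∀ {r} → Mat r r → Mat r r → Set
IsInverse F G = (∀ i j → (F ·ᴹ G) i j ≡ identity i j) ×
                (∀ i j → (G ·ᴹ F) i j ≡ identity i j)

Region : ℕ → Set₁
Region r = Vecℚ r → Set

_≐_ : ∀ {r} → Region r → Region r → Set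
P ≐ Q = ∀ x → P x ⇔ Q x

-- P_M = conv of the columns of [M | -M]: x = Σ λ_j M_j + Σ μ_j (-M_j),
-- λ, μ ≥ 0, Σ λ + Σ μ = 1.
Polytope : ∀ {r n} → Mat r n → Region r
Polytope {r} {n} M x =
  Σ (Fin n → ℚ) λ lam → Σ (Fin n → ℚ) λ mu →
    (∀ j → 0ℚ ℚ.≤ lam j) × (∀ j → 0ℚ ℚ.≤ mu j) ×
    (sumℚ lam ℚ.+ sumℚ mu ≡ 1ℚ) ×
    (∀ i → x i ≡ combo M lam i ℚ.+ combo M (λ j → ℚ.- (mu j)) i)

polar : ∀ {r} → Region r → Region r
polar P u = ∀ x → P x → dot u x ℚ.≤ 1ℚ

image : ∀ {r} → Mat r r → Region r → Region r
image F P x = Σ (Vecℚ _) λ y → P y × (∀ i → x i ≡ apply F y i)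

{-# OPTIONS --safe #-}
module Submission where

-- Fix a basis of the matroid and bring both matrices into standard form [ I ∣ A ] with respect to it.
-- A weakly unimodular matrix stays so under every change of basis, hence all entries that occur are
-- 0, 1 or -1, and the matroid determines which of them vanish.  It remains to see that two such matrices
-- A and B with A ≡ B (mod 2) differ only by signs of rows and columns (Camion), for then the two given
-- matrices differ by an element of GL_r(ℤ) and by a permutation and signs of the columns, which do not
-- affect the polytope.
--
-- Signs are adjusted one column at a time.  If A and B agree on the earlier columns, the next column can be
-- adjusted provided that the ratio of A and B in it is constant along every connected component of rows,
-- two rows being adjacent when they meet in an earlier column.  This is proved by induction on the length
-- of a walk between two rows: unless the walk can be shortened, pivoting on its first edge moves the entry of
-- the first row in the new column to the second row and leaves the rest of the walk intact.

open import Defs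
open import Algebra.Bundles using (CommutativeRing)
import Algebra.Properties.CommutativeMonoid.Sum as MonoidSum
import Algebra.Properties.Semiring.Sum as SemiringSum
open import Data.Fin using (Fin; zero; suc; _≟_; punchIn; punchOut; inject₁; toℕ)
open import Data.Fin.Permutation as Perm using (Permutation′; _⟨$⟩ʳ_; _⟨$⟩ˡ_; _∘ₚ_)
open import Data.Fin.Properties using (any?; suc-injective; punchInᵢ≢i; punchIn-injective; punchIn-punchOut; toℕ-inject₁)
open import Data.Fin.Subset using (Subset; inside; outside; ∣_∣) renaming (_∈_ to _∈ˢ_)
open import Data.Integer as ℤ using (ℤ; +_; -[1+_]; _+_; _*_; -_; _^_; _/_; _%_)
open import Data.Integer.DivMod using (a≡a%n+[a/n]*n; n%d<d)
import Data.Integer.Properties as ℤₚ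
open import Data.Integer.Tactic.RingSolver using (solve-∀)
open import Data.List using (List; []; _∷_; map; _++_; allFin)
open import Data.List.Membership.Propositional using (_∈_)
open import Data.List.Membership.Propositional.Properties using (∈-allFin)
open import Data.List.Relation.Unary.Any using (here; there)
open import Data.Nat as ℕ using (ℕ; zero; suc; _<_)
open import Data.Nat.Induction using (<-wellFounded)
import Data.Nat.Properties as ℕₚ
open import Data.Product using (Σ; ∃; ∃₂; _×_; _,_; proj₁; proj₂)
open import Data.Rational as ℚ using (ℚ; 0ℚ; 1ℚ)
import Data.Rational.Properties as ℚₚ
open import Data.Rational.Solver using (module +-*-Solver)
open import Data.Rational.Unnormalised as ℚᵘ using (mkℚᵘ; *≡*)
import Data.Rational.Unnormalised.Properties as ℚᵘₚ
open import Data.Sum using (_⊎_; inj₁; inj₂)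
open import Data.Vec as Vec using (tabulate; []; _∷_)
open import Data.Vec.Functional using (updateAt)
open import Data.Vec.Functional.Properties using (updateAt-updates; updateAt-minimal)
open import Data.Vec.Properties using (lookup∘tabulate; []=⇒lookup; lookup⇒[]=)
open import Function using (_∘_; const)
open import Function.Bundles using (_⇔_; mk⇔; Equivalence)
import Function.Construct.Composition as Compose
import Function.Construct.Symmetry as Symmetry
open import Function.Definitions using (Injective)
open import Induction.WellFounded using (Acc; acc)
open import Level using (0ℓ)
open import Relation.Binary.Construct.Closure.ReflexiveTransitive as Star using (Star; ε; _◅_; _◅◅_)
open import Relation.Binary.PropositionalEquality using (_≡_; _≢_; refl; sym; trans; cong; cong₂; subst; module ≡-Reasoning)
open import Relation.Nullary using (¬_; Dec; yes; no; does; contradiction; ¬?; _×-dec_; _⊎-dec_)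
open import Relation.Nullary.Decidable using (map′; dec-true)

-- Finite sums and matrices

-- `sumℤ` and `sumℚ` are separate recursions; the laws are derived once, for any sum satisfying the
-- two defining equations, by comparison with the library sum.
module FinSum (R : CommutativeRing 0ℓ 0ℓ)
  (sum : ∀ {n} → (Fin n → CommutativeRing.Carrier R) → CommutativeRing.Carrier R)
  (sum-[] : ∀ f → CommutativeRing._≈_ R (sum {zero} f) (CommutativeRing.0# R))
  (sum-∷ : ∀ {n} f → CommutativeRing._≈_ R (sum {suc n} f) (CommutativeRing._+_ R (f zero) (sum (f ∘ suc))))
  where

  open CommutativeRing R hiding (zero; refl)
    renaming (_+_ to _⊞_; _*_ to _⊠_; sym to ≈-sym; trans to ≈-trans)
  private
    module L = SemiringSum semiring
    module C = MonoidSum +-commutativeMonoid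

    sum≈ : ∀ {n} (f : Fin n → Carrier) → sum f ≈ L.sum f
    sum≈ {zero}  f = sum-[] f
    sum≈ {suc n} f = ≈-trans (sum-∷ f) (+-congˡ (sum≈ (f ∘ suc)))

  sum-cong : ∀ {n} {f g : Fin n → Carrier} → (∀ i → f i ≈ g i) → sum f ≈ sum g
  sum-cong {f = f} {g} h = ≈-trans (sum≈ f) (≈-trans (L.sum-cong-≋ h) (≈-sym (sum≈ g)))

  sum-+ : ∀ {n} (f g : Fin n → Carrier) → sum (λ i → f i ⊞ g i) ≈ sum f ⊞ sum g
  sum-+ f g = ≈-trans (sum≈ _) (≈-trans (C.∑-distrib-+ f g) (+-cong (≈-sym (sum≈ f)) (≈-sym (sum≈ g))))

  *-sum : ∀ {n} x (f : Fin n → Carrier) → x ⊠ sum f ≈ sum (λ i → x ⊠ f i)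
  *-sum x f = ≈-trans (*-congˡ (sum≈ f)) (≈-trans (L.*-distribˡ-sum x f) (≈-sym (sum≈ _)))

  sum-* : ∀ {n} x (f : Fin n → Carrier) → sum f ⊠ x ≈ sum (λ i → f i ⊠ x)
  sum-* x f = ≈-trans (*-congʳ (sum≈ f)) (≈-trans (L.*-distribʳ-sum x f) (≈-sym (sum≈ _)))

  sum-comm : ∀ {m n} (f : Fin m → Fin n → Carrier) →
             sum (λ i → sum (λ j → f i j)) ≈ sum (λ j → sum (λ i → f i j))
  sum-comm f = ≈-trans (sum-cong (λ i → sum≈ (f i))) (≈-trans (sum≈ _) (≈-trans (C.∑-comm f)
    (≈-trans (≈-sym (sum≈ _)) (sum-cong (λ j → ≈-sym (sum≈ (λ i → f i j)))))))

  sum-permute : ∀ {n} (f : Fin n → Carrier) (π : Permutation′ n) → sum f ≈ sum (λ i → f (π ⟨$⟩ʳ i))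
  sum-permute f π = ≈-trans (sum≈ f) (≈-trans (C.sum-permute f π) (≈-sym (sum≈ _)))

  sum-zero : ∀ {n} {f : Fin n → Carrier} → (∀ i → f i ≈ 0#) → sum f ≈ 0#
  sum-zero {n} {f} h = ≈-trans (sum≈ f) (≈-trans (L.sum-cong-≋ h) (L.sum-replicate-zero n))

  sum-single : ∀ {n} {f : Fin n → Carrier} p → (∀ i → i ≢ p → f i ≈ 0#) → sum f ≈ f p
  sum-single {suc n} {f} zero h = ≈-trans (sum-∷ f)
    (≈-trans (+-congˡ (sum-zero (λ i → h (suc i) λ ()))) (+-identityʳ _))
  sum-single {suc n} {f} (suc p) h = ≈-trans (sum-∷ f)
    (≈-trans (+-cong (h zero λ ()) (sum-single p (λ i i≢p → h (suc i) (i≢p ∘ suc-injective)))) (+-identityˡ _))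

  -- The exchange of summations behind associativity of matrix products, composition of `·ⱽ` and of
  -- `apply`, and the adjunction `dot-transpose`.
  sum-assoc : ∀ {m n} (a : Fin m → Carrier) (b : Fin m → Fin n → Carrier) (c : Fin n → Carrier) →
              sum (λ k → sum (λ l → a l ⊠ b l k) ⊠ c k) ≈ sum (λ l → a l ⊠ sum (λ k → b l k ⊠ c k))
  sum-assoc a b c =
    ≈-trans (sum-cong (λ k → sum-* (c k) _))
    (≈-trans (sum-comm _)
    (sum-cong (λ l → ≈-trans (sum-cong (λ k → *-assoc (a l) (b l k) (c k))) (≈-sym (*-sum (a l) _)))))

module Σℤ = FinSum ℤₚ.+-*-commutativeRing sumℤ (λ _ → refl) (λ _ → refl)
module Σℚ = FinSum ℚₚ.+-*-commutativeRing sumℚ (λ _ → refl) (λ _ → refl)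

-- Recursive, whereas `identity` goes by decision: `δ (suc i) (suc j)` reduces to `δ i j`, which
-- suits induction on the size of a matrix.
δ : ∀ {n} → Fin n → Fin n → ℤ
δ zero    zero    = + 1
δ zero    (suc _) = + 0
δ (suc _) zero    = + 0
δ (suc i) (suc j) = δ i j

δ-refl : ∀ {n} (i : Fin n) → δ i i ≡ + 1
δ-refl zero    = refl
δ-refl (suc i) = δ-refl i

δ-≢ : ∀ {n} {i j : Fin n} → i ≢ j → δ i j ≡ + 0
δ-≢ {i = zero}  {zero}  i≢j = contradiction refl i≢j
δ-≢ {i = zero}  {suc _} i≢j = refl
δ-≢ {i = suc _} {zero}  i≢j = refl
δ-≢ {i = suc i} {suc j} i≢j = δ-≢ (i≢j ∘ cong suc)

δ-sym : ∀ {n} (i j : Fin n) → δ i j ≡ δ j i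
δ-sym zero    zero    = refl
δ-sym zero    (suc _) = refl
δ-sym (suc _) zero    = refl
δ-sym (suc i) (suc j) = δ-sym i j

identity≡δ : ∀ {n} (i j : Fin n) → identity i j ≡ δ i j
identity≡δ i j with i ≟ j
... | yes refl = sym (δ-refl i)
... | no i≢j   = sym (δ-≢ i≢j)

sum-δ : ∀ {n} (p : Fin n) (f : Fin n → ℤ) → sumℤ (λ i → δ p i * f i) ≡ f p
sum-δ p f = trans (Σℤ.sum-single p (λ i i≢p → cong (_* f i) (δ-≢ (i≢p ∘ sym))))
  (trans (cong (_* f p) (δ-refl p)) (ℤₚ.*-identityˡ (f p)))

sum-δʳ : ∀ {n} (p : Fin n) (f : Fin n → ℤ) → sumℤ (λ i → f i * δ i p) ≡ f p
sum-δʳ p f = trans (Σℤ.sum-single p (λ i i≢p → trans (cong (f i *_) (δ-≢ i≢p)) (ℤₚ.*-zeroʳ (f i))))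
  (trans (cong (f p *_) (δ-refl p)) (ℤₚ.*-identityʳ (f p)))

infix 4 _≋_
_≋_ : ∀ {m n} → Mat m n → Mat m n → Set
A ≋ B = ∀ i j → A i j ≡ B i j

≋-sym : ∀ {m n} {A B : Mat m n} → A ≋ B → B ≋ A
≋-sym p i j = sym (p i j)

≋-trans : ∀ {m n} {A B C : Mat m n} → A ≋ B → B ≋ C → A ≋ C
≋-trans p q i j = trans (p i j) (q i j)

·-congˡ : ∀ {m k n} (A : Mat m k) {B C : Mat k n} → B ≋ C → (A ·ᴹ B) ≋ (A ·ᴹ C)
·-congˡ A p i j = Σℤ.sum-cong (λ l → cong (A i l *_) (p l j))

·-congʳ : ∀ {m k n} {A B : Mat m k} (C : Mat k n) → A ≋ B → (A ·ᴹ C) ≋ (B ·ᴹ C)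
·-congʳ C p i j = Σℤ.sum-cong (λ l → cong (_* C l j) (p i l))

·-assoc : ∀ {m k l n} (A : Mat m k) (B : Mat k l) (C : Mat l n) → ((A ·ᴹ B) ·ᴹ C) ≋ (A ·ᴹ (B ·ᴹ C))
·-assoc A B C i j = Σℤ.sum-assoc (A i) B (λ k → C k j)

·-identityˡ : ∀ {m n} (A : Mat m n) → (δ ·ᴹ A) ≋ A
·-identityˡ A i j = sum-δ i (λ l → A l j)

infixr 8 _·ⱽ_
_·ⱽ_ : ∀ {m n} → Mat m n → (Fin n → ℤ) → Fin m → ℤ
(A ·ⱽ v) i = sumℤ (λ l → A i l * v l)

·ⱽ-assoc : ∀ {m k n} (A : Mat m k) (B : Mat k n) v i → ((A ·ᴹ B) ·ⱽ v) i ≡ (A ·ⱽ (B ·ⱽ v)) i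
·ⱽ-assoc A B v i = Σℤ.sum-assoc (A i) B v

-- Determinants and adjacent column operations

minor : ∀ {k} → Mat (suc k) (suc k) → Fin (suc k) → Mat k k
minor A j i l = A (suc i) (punchIn j l)

sign : ∀ {k} → Fin k → ℤ
sign j = (- (+ 1)) ^ toℕ j

det-cong : ∀ {k} {A B : Mat k k} → A ≋ B → det A ≡ det B
det-cong {zero}  A≋B = refl
det-cong {suc k} A≋B = Σℤ.sum-cong λ j →
  cong (sign j *_) (cong₂ _*_ (A≋B zero j) (det-cong (λ i l → A≋B (suc i) (punchIn j l))))

-- Expand along the first row. In the term of column `b` the minor omits that column and only the
-- entry varies; in every other term the entry is fixed and the minor is linear by induction.
det-linear : ∀ {k} (b : Fin k) t (A B C : Mat k k) →
  (∀ i j → j ≢ b → A i j ≡ C i j) → (∀ i j → j ≢ b → B i j ≡ C i j) →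
  (∀ i → C i b ≡ A i b + t * B i b) → det C ≡ det A + t * det B
det-linear {suc k} b t A B C A≡C B≡C C-b = begin
  det C                                                         ≡⟨ Σℤ.sum-cong expand ⟩
  sumℤ (λ j → term A j + t * term B j)                          ≡⟨ Σℤ.sum-+ (term A) (λ j → t * term B j) ⟩
  det A + sumℤ (λ j → t * term B j)                             ≡⟨ cong (_+_ (det A)) (sym (Σℤ.*-sum t (term B))) ⟩
  det A + t * det B                                             ∎
  where
  open ≡-Reasoning
  term : Mat (suc k) (suc k) → Fin (suc k) → ℤ
  term X j = sign j * (X zero j * det (minor X j))
  at-b : ∀ s a b t d → s * ((a + t * b) * d) ≡ s * (a * d) + t * (s * (b * d))
  at-b = solve-∀
  off-b : ∀ s c t a b → s * (c * (a + t * b)) ≡ s * (c * a) + t * (s * (c * b))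
  off-b = solve-∀
  expand : ∀ j → term C j ≡ term A j + t * term B j
  expand j with j ≟ b
  ... | yes refl = begin
    sign b * (C zero b * det (minor C b))
      ≡⟨ cong (λ z → sign b * (z * det (minor C b))) (C-b zero) ⟩
    sign b * ((A zero b + t * B zero b) * det (minor C b))
      ≡⟨ at-b (sign b) (A zero b) (B zero b) t (det (minor C b)) ⟩
    sign b * (A zero b * det (minor C b)) + t * (sign b * (B zero b * det (minor C b)))
      ≡⟨ cong₂ (λ x y → sign b * (A zero b * x) + t * (sign b * (B zero b * y)))
           (det-cong (λ i l → sym (A≡C (suc i) _ (punchInᵢ≢i b l))))
           (det-cong (λ i l → sym (B≡C (suc i) _ (punchInᵢ≢i b l)))) ⟩
    term A b + t * term B b ∎
  ... | no j≢b = begin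
    sign j * (C zero j * det (minor C j))
      ≡⟨ cong (λ z → sign j * (C zero j * z))
           (det-linear b′ t (minor A j) (minor B j) (minor C j)
             (λ i l l≢b′ → A≡C (suc i) _ (l≢b′ ∘ away l))
             (λ i l l≢b′ → B≡C (suc i) _ (l≢b′ ∘ away l))
             (λ i → subst (λ z → C (suc i) z ≡ A (suc i) z + t * B (suc i) z) (sym b′≡) (C-b (suc i)))) ⟩
    sign j * (C zero j * (det (minor A j) + t * det (minor B j)))
      ≡⟨ off-b (sign j) (C zero j) t (det (minor A j)) (det (minor B j)) ⟩
    sign j * (C zero j * det (minor A j)) + t * (sign j * (C zero j * det (minor B j)))
      ≡⟨ cong₂ (λ x y → sign j * (x * det (minor A j)) + t * (sign j * (y * det (minor B j))))
           (sym (A≡C zero j j≢b)) (sym (B≡C zero j j≢b)) ⟩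
    term A j + t * term B j ∎
    where
    b′ = punchOut j≢b
    b′≡ : punchIn j b′ ≡ b
    b′≡ = punchIn-punchOut j≢b
    away : ∀ l → punchIn j l ≡ b → l ≡ b′
    away l eq = punchIn-injective j l b′ (trans eq (sym b′≡))

sum-adjacent : ∀ {n} (k : Fin n) (f : Fin (suc n) → ℤ) →
  (∀ j → j ≢ inject₁ k → j ≢ suc k → f j ≡ + 0) → f (inject₁ k) + f (suc k) ≡ + 0 → sumℤ f ≡ + 0
sum-adjacent {suc n} zero f off pair = begin
  f zero + (f (suc zero) + sumℤ (λ j → f (suc (suc j))))
    ≡⟨ cong (λ z → f zero + (f (suc zero) + z)) (Σℤ.sum-zero (λ j → off (suc (suc j)) (λ ()) (λ ()))) ⟩
  f zero + (f (suc zero) + + 0)  ≡⟨ cong (_+_ (f zero)) (ℤₚ.+-identityʳ _) ⟩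
  f zero + f (suc zero)          ≡⟨ pair ⟩
  + 0                            ∎
  where open ≡-Reasoning
sum-adjacent {suc n} (suc k) f off pair =
  cong₂ _+_ (off zero (λ ()) (λ ()))
    (sum-adjacent k (f ∘ suc) (λ j p q → off (suc j) (p ∘ suc-injective) (q ∘ suc-injective)) pair)

-- Deleting one or the other of two neighbouring columns leaves the same columns, except at one
-- position, where each deletion shows the column that the other removes.
punchIn-adjacent : ∀ {n} (k l : Fin n) → punchIn (inject₁ k) l ≡ punchIn (suc k) l
  ⊎ (punchIn (inject₁ k) l ≡ suc k × punchIn (suc k) l ≡ inject₁ k)
punchIn-adjacent zero    zero    = inj₂ (refl , refl)
punchIn-adjacent zero    (suc l) = inj₁ refl
punchIn-adjacent (suc k) zero    = inj₁ refl
punchIn-adjacent (suc k) (suc l) with punchIn-adjacent k l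
... | inj₁ p       = inj₁ (cong suc p)
... | inj₂ (p , q) = inj₂ (cong suc p , cong suc q)

-- Neighbouring columns stay neighbours in every minor that keeps both, so the induction in
-- `det-alternating` never leaves the adjacent case.
punchOut-adjacent : ∀ {n} (j : Fin (suc (suc n))) (k : Fin (suc n)) → j ≢ inject₁ k → j ≢ suc k →
  ∃ λ (k′ : Fin n) → punchIn j (inject₁ k′) ≡ inject₁ k × punchIn j (suc k′) ≡ suc k
punchOut-adjacent zero          zero    p q = contradiction refl p
punchOut-adjacent zero          (suc k) p q = k , refl , refl
punchOut-adjacent (suc zero)    zero    p q = contradiction refl q
punchOut-adjacent {suc n} (suc (suc j)) zero    p q = zero , refl , refl
punchOut-adjacent {suc n} (suc j) (suc k) p q
  with k′ , e , f ← punchOut-adjacent j k (p ∘ cong suc) (q ∘ cong suc) = suc k′ , cong suc e , cong suc f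

-- In the expansion, minors that keep both equal columns vanish by induction. The two remaining
-- minors coincide, and their signs are opposite because the columns are adjacent.
det-alternating : ∀ {n} (k : Fin n) (A : Mat (suc n) (suc n)) →
  (∀ i → A i (inject₁ k) ≡ A i (suc k)) → det A ≡ + 0
det-alternating {suc n} k A eq = sum-adjacent k _ off pair
  where
  open ≡-Reasoning
  zeros : ∀ s a → s * (a * + 0) ≡ + 0
  zeros = solve-∀
  off : ∀ j → j ≢ inject₁ k → j ≢ suc k → sign j * (A zero j * det (minor A j)) ≡ + 0
  off j p q with k′ , e , f ← punchOut-adjacent j k p q =
    trans (cong (λ z → sign j * (A zero j * z))
      (det-alternating k′ (minor A j) (λ i → trans (cong (A (suc i)) e) (trans (eq (suc i)) (cong (A (suc i)) (sym f))))))
      (zeros (sign j) (A zero j))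
  minors : ∀ i l → minor A (inject₁ k) i l ≡ minor A (suc k) i l
  minors i l with punchIn-adjacent k l
  ... | inj₁ p       = cong (A (suc i)) p
  ... | inj₂ (p , q) = trans (cong (A (suc i)) p) (trans (sym (eq (suc i))) (cong (A (suc i)) (sym q)))
  cancel : ∀ s x → s * x + (- (+ 1) * s) * x ≡ + 0
  cancel = solve-∀
  pair : sign (inject₁ k) * (A zero (inject₁ k) * det (minor A (inject₁ k)))
       + sign (suc k) * (A zero (suc k) * det (minor A (suc k))) ≡ + 0
  pair = trans (cong₂ (λ s x → s * x + sign (suc k) * (A zero (suc k) * det (minor A (suc k))))
      (cong (_^_ (- (+ 1))) (toℕ-inject₁ k)) (cong₂ _*_ (eq zero) (det-cong minors)))
    (cancel (sign k) (A zero (suc k) * det (minor A (suc k))))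

-- Column operations are confined to neighbours: the alternating law is proved for these, and
-- clearing a row from right to left uses no others.
data Adjacent : ∀ {n} → Fin n → Fin n → Set where
  up   : ∀ {n} (k : Fin n) → Adjacent (inject₁ k) (suc k)
  down : ∀ {n} (k : Fin n) → Adjacent (suc k) (inject₁ k)

addCol : ∀ {m n} → Fin n → Fin n → ℤ → Mat m n → Mat m n
addCol a b t C i j = C i j + δ b j * (t * C i a)

copyCol : ∀ {m n} → Fin n → Fin n → Mat m n → Mat m n
copyCol a b C i j with j ≟ b
... | yes _ = C i a
... | no  _ = C i j

copyCol-≡ : ∀ {m n} (a b : Fin n) (C : Mat m n) i → copyCol a b C i b ≡ C i a
copyCol-≡ a b C i with b ≟ b
... | yes _  = refl
... | no b≢b = contradiction refl b≢b

copyCol-≢ : ∀ {m n} (a b : Fin n) (C : Mat m n) i {j} → j ≢ b → copyCol a b C i j ≡ C i j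
copyCol-≢ a b C i {j} j≢b with j ≟ b
... | yes j≡b = contradiction j≡b j≢b
... | no _    = refl

addCol-≡ : ∀ {m n} (a b : Fin n) t (C : Mat m n) i → addCol a b t C i b ≡ C i b + t * C i a
addCol-≡ a b t C i rewrite δ-refl b = cong (_+_ (C i b)) (ℤₚ.*-identityˡ _)

addCol-≢ : ∀ {m n} (a b : Fin n) t (C : Mat m n) i {j} → j ≢ b → addCol a b t C i j ≡ C i j
addCol-≢ a b t C i {j} j≢b rewrite δ-≢ {i = b} {j} (j≢b ∘ sym) = ℤₚ.+-identityʳ _

inject₁≢suc : ∀ {n} (k : Fin n) → inject₁ k ≢ suc k
inject₁≢suc (suc k) eq = inject₁≢suc k (suc-injective eq)

-- By linearity in column `b` the change is `t` times the determinant of a matrix in which columns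
-- `a` and `b` are equal neighbours.
det-addCol : ∀ {n} {a b : Fin n} → Adjacent a b → ∀ t (C : Mat n n) → det (addCol a b t C) ≡ det C
det-addCol {n} {a} {b} adj t C = begin
  det (addCol a b t C)              ≡⟨ det-linear b t C (copyCol a b C) (addCol a b t C)
                                         (λ i j j≢b → sym (addCol-≢ a b t C i j≢b))
                                         (λ i j j≢b → trans (copyCol-≢ a b C i j≢b) (sym (addCol-≢ a b t C i j≢b)))
                                         (λ i → trans (addCol-≡ a b t C i) (cong (λ z → C i b + t * z) (sym (copyCol-≡ a b C i)))) ⟩
  det C + t * det (copyCol a b C)   ≡⟨ cong (λ z → det C + t * z) (vanish adj C) ⟩
  det C + t * + 0                   ≡⟨ cong (_+_ (det C)) (ℤₚ.*-zeroʳ t) ⟩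
  det C + + 0                       ≡⟨ ℤₚ.+-identityʳ _ ⟩
  det C                             ∎
  where
  open ≡-Reasoning
  vanish : ∀ {n} {a b : Fin n} → Adjacent a b → (C : Mat n n) → det (copyCol a b C) ≡ + 0
  vanish (up k)   C = det-alternating k (copyCol (inject₁ k) (suc k) C) λ i →
    trans (copyCol-≢ (inject₁ k) (suc k) C i (inject₁≢suc k)) (sym (copyCol-≡ (inject₁ k) (suc k) C i))
  vanish (down k) C = det-alternating k (copyCol (suc k) (inject₁ k) C) λ i →
    trans (copyCol-≡ (suc k) (inject₁ k) C i) (sym (copyCol-≢ (suc k) (inject₁ k) C i (inject₁≢suc k ∘ sym)))

-- Integer column reduction and unimodularity

data ColOp (n : ℕ) : Set where
  op : ∀ {a b : Fin n} → Adjacent a b → ℤ → ColOp n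

applyOp : ∀ {m n} → ColOp n → Mat m n → Mat m n
applyOp (op {a} {b} _ t) = addCol a b t

run : ∀ {m n} → List (ColOp n) → Mat m n → Mat m n
run []       C = C
run (o ∷ os) C = run os (applyOp o C)

run-++ : ∀ {m n} (os ps : List (ColOp n)) (C : Mat m n) → run (os ++ ps) C ≡ run ps (run os C)
run-++ []       ps C = refl
run-++ (o ∷ os) ps C = run-++ os ps (applyOp o C)

det-run : ∀ {n} (os : List (ColOp n)) (C : Mat n n) → det (run os C) ≡ det C
det-run []              C = refl
det-run (op adj t ∷ os) C = trans (det-run os _) (det-addCol adj t C)

shiftOp : ∀ {n} → ColOp n → ColOp (suc n)
shiftOp (op (up k)   t) = op (up (suc k)) t
shiftOp (op (down k) t) = op (down (suc k)) t

run-shift : ∀ {m n} (os : List (ColOp n)) (C : Mat m (suc n)) i j →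
  run (map shiftOp os) C i (suc j) ≡ run os (λ i j → C i (suc j)) i j
run-shift []                     C i j = refl
run-shift (op (up k)   t ∷ os) C i j = run-shift os (addCol (suc (inject₁ k)) (suc (suc k)) t C) i j
run-shift (op (down k) t ∷ os) C i j = run-shift os (addCol (suc (suc k)) (suc (inject₁ k)) t C) i j

-- With q = x / y, the two operations take the pair (x , y) to (x + (1 - q) y , - (x % y)).
euclid : ∀ {m n} (C : Mat (suc m) (suc (suc n))) → Acc ℕ._<_ ℤ.∣ C zero (suc zero) ∣ →
  ∃ λ os → run os C zero (suc zero) ≡ + 0 × (∀ j → run os C zero (suc (suc j)) ≡ C zero (suc (suc j)))
euclid C (acc rec) with C zero (suc zero) ℤₚ.≟ + 0
... | yes y≡0 = [] , y≡0 , λ _ → refl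
... | no y≢0 = let os , end , rest = euclid C₂ (rec smaller) in ops os , end , λ j → trans (rest j) (unchanged j)
  where
  open ≡-Reasoning
  x = C zero zero
  y = C zero (suc zero)
  instance nz : ℤ.NonZero y
           nz = ℤ.≢-nonZero y≢0
  t = + 1 + - (x / y)
  C₁ = addCol (suc zero) zero t C
  C₂ = addCol zero (suc zero) (- (+ 1)) C₁
  ops : List (ColOp _) → List (ColOp _)
  ops os = op (down zero) t ∷ op (up zero) (- (+ 1)) ∷ os
  identity₁ : ∀ r q y → y + - (+ 1) * ((r + q * y) + (+ 1 + - q) * y) ≡ - r
  identity₁ = solve-∀
  value : C₂ zero (suc zero) ≡ - (+ (x % y))
  value = begin
    C₂ zero (suc zero)                             ≡⟨ addCol-≡ zero (suc zero) (- (+ 1)) C₁ zero ⟩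
    C₁ zero (suc zero) + - (+ 1) * C₁ zero zero
      ≡⟨ cong₂ (λ u v → u + - (+ 1) * v) (addCol-≢ (suc zero) zero t C zero (λ ())) (addCol-≡ (suc zero) zero t C zero) ⟩
    y + - (+ 1) * (x + t * y)
      ≡⟨ cong (λ z → y + - (+ 1) * (z + t * y)) (a≡a%n+[a/n]*n x y) ⟩
    y + - (+ 1) * ((+ (x % y) + (x / y) * y) + t * y)  ≡⟨ identity₁ (+ (x % y)) (x / y) y ⟩
    - (+ (x % y))                                  ∎
  smaller : ℤ.∣ C₂ zero (suc zero) ∣ ℕ.< ℤ.∣ y ∣
  smaller = subst (ℕ._< ℤ.∣ y ∣) (sym (trans (cong ℤ.∣_∣ value) (ℤₚ.∣-i∣≡∣i∣ (+ (x % y))))) (n%d<d x y)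
  unchanged : ∀ j → C₂ zero (suc (suc j)) ≡ C zero (suc (suc j))
  unchanged j = trans (addCol-≢ zero (suc zero) (- (+ 1)) C₁ zero λ ()) (addCol-≢ (suc zero) zero t C zero λ ())

-- The row is cleared from the right: recursion without column zero leaves at most the first two
-- entries nonzero, and the Euclidean algorithm on these two columns leaves the others alone.
reduceRow : ∀ {m n} (C : Mat (suc m) (suc n)) → ∃ λ os → ∀ j → run os C zero (suc j) ≡ + 0
reduceRow {n = zero}  C = [] , λ ()
reduceRow {n = suc n} C
  with os , tail-zero ← reduceRow (λ i j → C i (suc j))
  with ps , head-zero , rest ← euclid (run (map shiftOp os) C) (<-wellFounded _)
  = map shiftOp os ++ ps , λ j → trans (cong (λ D → D zero (suc j)) (run-++ (map shiftOp os) ps C)) (zeros j)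
  where
  zeros : ∀ j → run ps (run (map shiftOp os) C) zero (suc j) ≡ + 0
  zeros zero    = head-zero
  zeros (suc j) = trans (rest j) (trans (run-shift os C zero (suc j)) (tail-zero j))

HasKernel : ∀ {m n} → Mat m n → Set
HasKernel C = ∃₂ λ v p → v p ≢ + 0 × (∀ i → (C ·ⱽ v) i ≡ + 0)

RightInvertible : ∀ {m n} → Mat m n → Set
RightInvertible C = ∃ λ R → C ·ᴹ R ≋ δ

addRow : ∀ {n} → Fin n → Fin n → ℤ → (Fin n → ℤ) → Fin n → ℤ
addRow a b t v l = v l + δ a l * (t * v b)

-- A column operation on the matrix is the transposed row operation on the vector. Kernel vectors
-- and right inverses are thereby carried from the reduced matrix back to the original one.
addCol-·ⱽ : ∀ {m n} (a b : Fin n) t (C : Mat m n) v i → (addCol a b t C ·ⱽ v) i ≡ (C ·ⱽ addRow a b t v) i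
addCol-·ⱽ a b t C v i = begin
  sumℤ (λ l → (C i l + δ b l * (t * C i a)) * v l)
    ≡⟨ Σℤ.sum-cong (λ l → expand (C i l) (δ b l) (t * C i a) (v l)) ⟩
  sumℤ (λ l → C i l * v l + δ b l * (t * C i a * v l))
    ≡⟨ Σℤ.sum-+ (λ l → C i l * v l) (λ l → δ b l * (t * C i a * v l)) ⟩
  sumℤ (λ l → C i l * v l) + sumℤ (λ l → δ b l * (t * C i a * v l))
    ≡⟨ cong (_+_ (sumℤ (λ l → C i l * v l))) (trans (sum-δ b (λ l → t * C i a * v l))
         (trans (swap t (C i a) (v b)) (sym (sum-δ a (λ l → C i l * (t * v b)))))) ⟩
  sumℤ (λ l → C i l * v l) + sumℤ (λ l → δ a l * (C i l * (t * v b)))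
    ≡⟨ Σℤ.sum-+ (λ l → C i l * v l) (λ l → δ a l * (C i l * (t * v b))) ⟨
  sumℤ (λ l → C i l * v l + δ a l * (C i l * (t * v b)))
    ≡⟨ Σℤ.sum-cong (λ l → collect (C i l) (v l) (δ a l) (t * v b)) ⟩
  sumℤ (λ l → C i l * (v l + δ a l * (t * v b))) ∎
  where
  open ≡-Reasoning
  expand : ∀ c d x v → (c + d * x) * v ≡ c * v + d * (x * v)
  expand = solve-∀
  swap : ∀ t c v → t * c * v ≡ c * (t * v)
  swap = solve-∀
  collect : ∀ c v d x → c * v + d * (c * x) ≡ c * (v + d * x)
  collect = solve-∀

adjacent-≢ : ∀ {n} {a b : Fin n} → Adjacent a b → a ≢ b
adjacent-≢ (up k)   = inject₁≢suc k
adjacent-≢ (down k) = inject₁≢suc k ∘ sym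

run-kernel : ∀ {m n} os (C : Mat m n) → HasKernel (run os C) → HasKernel C
run-kernel []                      C k = k
run-kernel (op {a} {b} adj t ∷ os) C k with v , p , vp≢0 , Cv≡0 ← run-kernel os (addCol a b t C) k
  = addRow a b t v , proj₁ nonzero , proj₂ nonzero , λ i → trans (sym (addCol-·ⱽ a b t C v i)) (Cv≡0 i)
  where
  -- Only coordinate `a` changes, and by a multiple of `v b`. If `v b` is nonzero, it survives at
  -- `b`; otherwise `v` itself is unchanged.
  nonzero : ∃ λ p → addRow a b t v p ≢ + 0
  nonzero with v b ℤₚ.≟ + 0
  ... | no vb≢0  = b , λ e → vb≢0 (trans (sym (trans (cong (λ d → v b + d * (t * v b)) (δ-≢ (adjacent-≢ adj)))
                         (ℤₚ.+-identityʳ (v b)))) e)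
  ... | yes vb≡0 = p , λ e → vp≢0 (trans (sym (trans (cong (λ z → v p + δ a p * (t * z)) vb≡0)
                         (zeros (v p) (δ a p) t))) e)
    where
    zeros : ∀ x d t → x + d * (t * + 0) ≡ x
    zeros = solve-∀

run-invertible : ∀ {m n} os (C : Mat m n) → RightInvertible (run os C) → RightInvertible C
run-invertible []                      C r = r
run-invertible (op {a} {b} adj t ∷ os) C r with R , CR≡1 ← run-invertible os (addCol a b t C) r
  = (λ l q → addRow a b t (λ k → R k q) l) ,
    λ i q → trans (sym (addCol-·ⱽ a b t C (λ k → R k q) i)) (CR≡1 i q)

consⱽ : ∀ {n} → ℤ → (Fin n → ℤ) → Fin (suc n) → ℤ
consⱽ x v zero    = x
consⱽ x v (suc i) = v i

reduced-kernel : ∀ {m n} (C : Mat (suc m) (suc n)) → (∀ j → C zero (suc j) ≡ + 0) →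
  HasKernel (λ i j → C (suc i) (suc j)) → HasKernel C
reduced-kernel C row (v , p , vp≢0 , Cv≡0) = consⱽ (+ 0) v , suc p , vp≢0 , kills
  where
  drop : ∀ i → (C ·ⱽ consⱽ (+ 0) v) i ≡ sumℤ (λ l → C i (suc l) * v l)
  drop i = trans (cong (_+ sumℤ (λ l → C i (suc l) * v l)) (ℤₚ.*-zeroʳ (C i zero))) (ℤₚ.+-identityˡ _)
  kills : ∀ i → (C ·ⱽ consⱽ (+ 0) v) i ≡ + 0
  kills zero    = trans (drop zero) (Σℤ.sum-zero (λ l → cong (_* v l) (row l)))
  kills (suc i) = trans (drop (suc i)) (Cv≡0 i)

-- After the reduction the first row constrains coordinate zero alone, and the remaining block again
-- has one column more than rows.
wide-kernel : ∀ m (C : Mat m (suc m)) → HasKernel C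
wide-kernel zero    C = (λ _ → + 1) , zero , (λ ()) , λ ()
wide-kernel (suc m) C with os , row ← reduceRow C =
  run-kernel os C (reduced-kernel (run os C) row (wide-kernel m (λ i j → run os C (suc i) (suc j))))

IsSign : ℤ → Set
IsSign z = (z ≡ + 1) ⊎ (z ≡ - (+ 1))

sign-square : ∀ {z} → IsSign z → z * z ≡ + 1
sign-square (inj₁ refl) = refl
sign-square (inj₂ refl) = refl

sign-factor : ∀ x y → IsSign (x * y) → IsSign x
sign-factor x y s = unit x (ℕₚ.m*n≡1⇒m≡1 ℤ.∣ x ∣ ℤ.∣ y ∣ (trans (sym (ℤₚ.abs-* x y)) (abs s)))
  where
  abs : ∀ {z} → IsSign z → ℤ.∣ z ∣ ≡ 1
  abs (inj₁ refl) = refl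
  abs (inj₂ refl) = refl
  unit : ∀ x → ℤ.∣ x ∣ ≡ 1 → IsSign x
  unit (+ 1)    refl = inj₁ refl
  unit -[1+ 0 ] refl = inj₂ refl

det-reduced : ∀ {n} (C : Mat (suc n) (suc n)) → (∀ j → C zero (suc j) ≡ + 0) →
  det C ≡ C zero zero * det (minor C zero)
det-reduced C row = begin
  det C ≡⟨ cong₂ _+_ (ℤₚ.*-identityˡ (C zero zero * det (minor C zero))) (Σℤ.sum-zero (λ j →
    trans (cong (λ z → sign (suc j) * (z * det (minor C (suc j)))) (row j)) (ℤₚ.*-zeroʳ (sign (suc j))))) ⟩
  C zero zero * det (minor C zero) + + 0 ≡⟨ ℤₚ.+-identityʳ _ ⟩
  C zero zero * det (minor C zero)       ∎
  where open ≡-Reasoning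

-- With corner `g`, first column `w` below it and block inverse `R`, the inverse is block triangular
-- with corner `g`, which is its own inverse, lower left part `- R w g` and block `R`.
reduced-invertible : ∀ {n} (C : Mat (suc n) (suc n)) → (∀ j → C zero (suc j) ≡ + 0) →
  IsSign (C zero zero) → RightInvertible (minor C zero) → RightInvertible C
reduced-invertible C row g-sign (R , DR≡1) = R′ , check
  where
  open ≡-Reasoning
  g = C zero zero
  w = λ k → C (suc k) zero
  R′ : Mat _ _
  R′ zero    zero    = g
  R′ zero    (suc q) = + 0
  R′ (suc l) zero    = (R ·ⱽ w) l * - g
  R′ (suc l) (suc q) = R l q
  top : ∀ q x → C zero zero * x + sumℤ (λ l → C zero (suc l) * R′ (suc l) q) ≡ C zero zero * x
  top q x = trans (cong (_+_ (g * x)) (Σℤ.sum-zero (λ l → cong (_* R′ (suc l) q) (row l)))) (ℤₚ.+-identityʳ _)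
  cancel : ∀ w g → w * g + w * - g ≡ + 0
  cancel = solve-∀
  check : C ·ᴹ R′ ≋ δ
  check zero    zero    = trans (top zero g) (sign-square g-sign)
  check zero    (suc q) = trans (top (suc q) (+ 0)) (ℤₚ.*-zeroʳ g)
  check (suc i) zero    = begin
    w i * g + sumℤ (λ l → minor C zero i l * ((R ·ⱽ w) l * - g))
      ≡⟨ cong (_+_ (w i * g)) (trans (Σℤ.sum-cong (λ l → sym (ℤₚ.*-assoc (minor C zero i l) ((R ·ⱽ w) l) (- g))))
           (sym (Σℤ.sum-* (- g) (λ l → minor C zero i l * (R ·ⱽ w) l)))) ⟩
    w i * g + (minor C zero ·ⱽ (R ·ⱽ w)) i * - g
      ≡⟨ cong (λ z → w i * g + z * - g) (begin
           (minor C zero ·ⱽ (R ·ⱽ w)) i   ≡⟨ ·ⱽ-assoc (minor C zero) R w i ⟨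
           ((minor C zero ·ᴹ R) ·ⱽ w) i   ≡⟨ Σℤ.sum-cong (λ l → cong (_* w l) (DR≡1 i l)) ⟩
           (δ ·ⱽ w) i                     ≡⟨ sum-δ i w ⟩
           w i                            ∎) ⟩
    w i * g + w i * - g   ≡⟨ cancel (w i) g ⟩
    + 0                   ∎
  check (suc i) (suc q) = trans (cong (_+ (minor C zero ·ᴹ R) i q) (ℤₚ.*-zeroʳ (w i)))
    (trans (ℤₚ.+-identityˡ _) (DR≡1 i q))

-- After the reduction the determinant is the corner times the minor. If the minor vanishes,
-- induction applies; if the corner does, the first row is zero and the other rows form a wide
-- matrix.
det≡0⇒kernel : ∀ n (C : Mat n n) → det C ≡ + 0 → HasKernel C
det≡0⇒kernel (suc n) C det≡0 with os , row ← reduceRow C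
  with ℤₚ.i*j≡0⇒i≡0∨j≡0 (run os C zero zero)
         (trans (sym (det-reduced (run os C) row)) (trans (det-run os C) det≡0))
... | inj₂ minor≡0 = run-kernel os C (reduced-kernel (run os C) row (det≡0⇒kernel n _ minor≡0))
... | inj₁ corner≡0 with v , p , vp≢0 , Dv≡0 ← wide-kernel n (λ i j → run os C (suc i) j)
  = run-kernel os C (v , p , vp≢0 , kills)
  where
  kills : ∀ i → (run os C ·ⱽ v) i ≡ + 0
  kills zero    = cong₂ _+_ (cong (_* v zero) corner≡0) (Σℤ.sum-zero (λ l → cong (_* v (suc l)) (row l)))
  kills (suc i) = Dv≡0 i

-- Corner and minor of the reduced matrix multiply to a unit of ℤ, so both are signs and induction
-- inverts the block.
det-sign⇒invertible : ∀ n (C : Mat n n) → IsSign (det C) → RightInvertible C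
det-sign⇒invertible zero    C s = C , λ ()
det-sign⇒invertible (suc n) C s with os , row ← reduceRow C =
  run-invertible os C (reduced-invertible D row (sign-factor (D zero zero) d gd-sign)
    (det-sign⇒invertible n (minor D zero) (sign-factor d (D zero zero) (subst IsSign (ℤₚ.*-comm (D zero zero) d) gd-sign))))
  where
  D = run os C
  d = det (minor D zero)
  gd-sign : IsSign (D zero zero * d)
  gd-sign = subst IsSign (trans (sym (det-run os C)) (det-reduced D row)) s

-- Unimodularity without determinants

cols : ∀ {m n k} → Mat m n → (Fin k → Fin n) → Mat m k
cols M c i l = M i (c l)

TrivialKernel : ∀ {m n} → Mat m n → Set
TrivialKernel C = ∀ v → (∀ i → (C ·ⱽ v) i ≡ + 0) → ∀ l → v l ≡ + 0

-- Weak unimodularity phrased through kernels and integer inverses, which makes stability under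
-- change of basis and under signs a matter of matrix algebra. The selection may repeat columns; a
-- trivial kernel excludes this.
Unimodular : ∀ {r n} → Mat r n → Set
Unimodular {r} {n} M = ∀ (c : Fin r → Fin n) → TrivialKernel (cols M c) → RightInvertible (cols M c)

-- A column chosen at two positions `a` and `b` gives the kernel vector with entries 1 at `a` and -1
-- at `b`.
trivialKernel⇒injective : ∀ {r n k} (M : Mat r n) (c : Fin k → Fin n) → TrivialKernel (cols M c) → Injective _≡_ _≡_ c
trivialKernel⇒injective M c triv {a} {b} ca≡cb with a ≟ b
... | yes a≡b = a≡b
... | no a≢b  = contradiction (trans (sym va≡1) (triv v kills a)) λ ()
  where
  open ≡-Reasoning
  v = λ l → δ a l + - δ b l
  va≡1 : v a ≡ + 1
  va≡1 = cong₂ (λ x y → x + - y) (δ-refl a) (δ-≢ (a≢b ∘ sym))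
  split : ∀ m x y → m * (x + - y) ≡ x * m + y * - m
  split = solve-∀
  kills : ∀ i → (cols M c ·ⱽ v) i ≡ + 0
  kills i = begin
    sumℤ (λ l → M i (c l) * v l)                    ≡⟨ Σℤ.sum-cong (λ l → split (M i (c l)) (δ a l) (δ b l)) ⟩
    sumℤ (λ l → δ a l * M i (c l) + δ b l * - M i (c l))
      ≡⟨ Σℤ.sum-+ (λ l → δ a l * M i (c l)) (λ l → δ b l * - M i (c l)) ⟩
    sumℤ (λ l → δ a l * M i (c l)) + sumℤ (λ l → δ b l * - M i (c l))
      ≡⟨ cong₂ _+_ (sum-δ a (λ l → M i (c l))) (sum-δ b (λ l → - M i (c l))) ⟩
    M i (c a) + - M i (c b)                         ≡⟨ cong (λ e → M i e + - M i (c b)) ca≡cb ⟩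
    M i (c b) + - M i (c b)                         ≡⟨ ℤₚ.+-inverseʳ (M i (c b)) ⟩
    + 0                                             ∎

weaklyUnimodular⇒unimodular : ∀ {r n} (M : Mat r n) → FullRankWeaklyUnimodular M → Unimodular M
weaklyUnimodular⇒unimodular {r} M (_ , minors) c triv
  with minors c (trivialKernel⇒injective M c triv)
... | inj₂ s = det-sign⇒invertible r (cols M c) s
... | inj₁ det≡0 with v , p , vp≢0 , Cv≡0 ← det≡0⇒kernel r (cols M c) det≡0
  = contradiction (triv v Cv≡0 p) vp≢0

-- Signings of unimodular matrices

-- A kernel vector of chosen columns of `A` also kills those of `B = P A`. So the columns of `A`
-- have an integer inverse `R` whenever those of `B` have trivial kernel, and `R Q` inverts the
-- latter.
unimodular-· : ∀ {r n} {P Q : Mat r r} {A B : Mat r n} → P ·ᴹ Q ≋ δ → B ≋ P ·ᴹ A → Unimodular A → Unimodular B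
unimodular-· {P = P} {Q} {A} {B} PQ≋1 B≋PA uA c triv = R ·ᴹ Q , inverse
  where
  open ≡-Reasoning
  B-kills : ∀ v → (∀ i → (cols A c ·ⱽ v) i ≡ + 0) → ∀ i → (cols B c ·ⱽ v) i ≡ + 0
  B-kills v Av≡0 i = begin
    (cols B c ·ⱽ v) i          ≡⟨ Σℤ.sum-cong (λ l → cong (_* v l) (B≋PA i (c l))) ⟩
    ((P ·ᴹ cols A c) ·ⱽ v) i   ≡⟨ ·ⱽ-assoc P (cols A c) v i ⟩
    (P ·ⱽ (cols A c ·ⱽ v)) i   ≡⟨ Σℤ.sum-zero (λ l → trans (cong (P i l *_) (Av≡0 l)) (ℤₚ.*-zeroʳ (P i l))) ⟩
    + 0                        ∎
  invertible : RightInvertible (cols A c)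
  invertible = uA c λ v Av≡0 → triv v (B-kills v Av≡0)
  R = proj₁ invertible
  inverse : cols B c ·ᴹ (R ·ᴹ Q) ≋ δ
  inverse = ≋-trans (·-congʳ (R ·ᴹ Q) (λ i l → B≋PA i (c l)))
    (≋-trans (·-assoc P (cols A c) (R ·ᴹ Q))
    (≋-trans (·-congˡ P (≋-trans (≋-sym (·-assoc (cols A c) R Q)) (≋-trans (·-congʳ Q (proj₂ invertible)) (·-identityˡ Q))))
    PQ≋1))

-- Pivoting

shear : ∀ {r n} → Fin r → (Fin r → ℤ) → Mat r n → Mat r n
shear i m A p q = A p q + m p * A i q

shear-δ-· : ∀ {r n} i m (A : Mat r n) → shear i m δ ·ᴹ A ≋ shear i m A
shear-δ-· i m A p q = begin
  sumℤ (λ l → (δ p l + m p * δ i l) * A l q)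
    ≡⟨ Σℤ.sum-cong (λ l → expand (δ p l) (m p) (δ i l) (A l q)) ⟩
  sumℤ (λ l → δ p l * A l q + δ i l * (m p * A l q))
    ≡⟨ Σℤ.sum-+ (λ l → δ p l * A l q) (λ l → δ i l * (m p * A l q)) ⟩
  sumℤ (λ l → δ p l * A l q) + sumℤ (λ l → δ i l * (m p * A l q))
    ≡⟨ cong₂ _+_ (sum-δ p (λ l → A l q)) (sum-δ i (λ l → m p * A l q)) ⟩
  A p q + m p * A i q ∎
  where
  open ≡-Reasoning
  expand : ∀ d m e a → (d + m * e) * a ≡ d * a + e * (m * a)
  expand = solve-∀

-- As `m i` vanishes, row `i` is itself unchanged, and subtracting the same multiples of it undoes
-- the shear.
shear-unimodular : ∀ {r n} i m (A : Mat r n) → m i ≡ + 0 → Unimodular A → Unimodular (shear i m A)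
shear-unimodular i m A mi≡0 = unimodular-· {P = shear i m δ} {shear i (λ p → - m p) δ} {A}
  (λ p q → trans (shear-δ-· i m (shear i (λ p → - m p) δ) p q)
    (trans (cong (λ z → δ p q + - m p * δ i q + m p * (δ i q + - z * δ i q)) mi≡0) (cancel (δ p q) (m p) (δ i q))))
  (≋-sym (shear-δ-· i m A))
  where
  cancel : ∀ d m e → d + - m * e + m * (e + - (+ 0) * e) ≡ d
  cancel = solve-∀

-- The diagonal entries are only required to be nonzero, so that a pivot may leave its sign on the
-- diagonal without rescaling the row.
Standard : ∀ {r n} → Mat r n → (Fin r → Fin n) → Set
Standard A β = (∀ i l → i ≢ l → A i (β l) ≡ + 0) × (∀ l → A l (β l) ≢ + 0)

Trit : ℤ → Set
Trit z = (z ≡ + 0) ⊎ IsSign z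

trit-≢0 : ∀ {z} → Trit z → z ≢ + 0 → IsSign z
trit-≢0 (inj₁ z≡0) z≢0 = contradiction z≡0 z≢0
trit-≢0 (inj₂ s)   _   = s

sign-≢0 : ∀ {z} → IsSign z → z ≢ + 0
sign-≢0 (inj₁ refl) ()
sign-≢0 (inj₂ refl) ()

sign-* : ∀ {x y} → IsSign x → IsSign y → IsSign (x * y)
sign-* (inj₁ refl) (inj₁ refl) = inj₁ refl
sign-* (inj₁ refl) (inj₂ refl) = inj₂ refl
sign-* (inj₂ refl) (inj₁ refl) = inj₂ refl
sign-* (inj₂ refl) (inj₂ refl) = inj₁ refl

sign-neg : ∀ {x} → IsSign x → IsSign (- x)
sign-neg (inj₁ refl) = inj₂ refl
sign-neg (inj₂ refl) = inj₁ refl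

*-zero-factor : ∀ {x y} → x ≢ + 0 → x * y ≡ + 0 → y ≡ + 0
*-zero-factor {x} x≢0 xy≡0 with ℤₚ.i*j≡0⇒i≡0∨j≡0 x xy≡0
... | inj₁ x≡0 = contradiction x≡0 x≢0
... | inj₂ y≡0 = y≡0

-- A nonzero entry (i , j) can be exchanged into the basis, so it is the corner of an invertible
-- integer matrix whose i-th row vanishes elsewhere.
entry-trit : ∀ {r n} {A : Mat r n} {β} → Unimodular A → Standard A β → ∀ i j → Trit (A i j)
entry-trit {r} {n} {A} {β} uA (off , diag) i j with A i j ℤₚ.≟ + 0
... | yes Aij≡0 = inj₁ Aij≡0
... | no Aij≢0  = inj₂ (sign-factor (A i j) (R i i) (inj₁ unit))
  where
  c : Fin r → Fin n
  c = updateAt β i (const j)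
  ci≡j : c i ≡ j
  ci≡j = updateAt-updates i β
  c≡β : ∀ {l} → l ≢ i → c l ≡ β l
  c≡β {l} l≢i = updateAt-minimal l i β l≢i
  row-i : ∀ (x : Fin r → ℤ) → sumℤ (λ l → A i (c l) * x l) ≡ A i j * x i
  row-i x = trans (Σℤ.sum-single i λ l l≢i → cong (_* x l) (trans (cong (A i) (c≡β l≢i)) (off i l (l≢i ∘ sym))))
    (cong (λ e → A i e * x i) ci≡j)
  triv : TrivialKernel (cols A c)
  triv v Av≡0 l with l ≟ i
  ... | yes refl = *-zero-factor Aij≢0 (trans (sym (row-i v)) (Av≡0 i))
  ... | no l≢i   = *-zero-factor (diag l) (trans (sym (trans (Σℤ.sum-single l others)
                     (cong (λ e → A l e * v l) (c≡β l≢i)))) (Av≡0 l))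
    where
    vi≡0 : v i ≡ + 0
    vi≡0 = *-zero-factor Aij≢0 (trans (sym (row-i v)) (Av≡0 i))
    others : ∀ k → k ≢ l → A l (c k) * v k ≡ + 0
    others k k≢l with k ≟ i
    ... | yes refl = trans (cong (A l (c i) *_) vi≡0) (ℤₚ.*-zeroʳ (A l (c i)))
    ... | no k≢i   = cong (_* v k) (trans (cong (A l) (c≡β k≢i)) (off l k (k≢l ∘ sym)))
  R = proj₁ (uA c triv)
  unit : A i j * R i i ≡ + 1
  unit = trans (sym (row-i (λ l → R l i))) (trans (proj₂ (uA c triv) i i) (δ-refl i))

-- Column `j` replaces the `i`-th basis column. The other basis columns vanish in row `i` and are
-- therefore not affected by the shear.
pivot-standard : ∀ {r n} {A : Mat r n} {β} i j (m : Fin r → ℤ) → m i ≡ + 0 → A i j ≢ + 0 →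
  (∀ p → p ≢ i → A p j + m p * A i j ≡ + 0) → Standard A β → Standard (shear i m A) (updateAt β i (const j))
pivot-standard {r} {n} {A} {β} i j m mi≡0 Aij≢0 clears (off , diag) = off′ , diag′
  where
  β′ = updateAt β i (const j)
  unchanged : ∀ p l → l ≢ i → shear i m A p (β′ l) ≡ A p (β l)
  unchanged p l l≢i rewrite updateAt-minimal l i {const j} β l≢i | off i l (l≢i ∘ sym) | ℤₚ.*-zeroʳ (m p) = ℤₚ.+-identityʳ _
  off′ : ∀ p l → p ≢ l → shear i m A p (β′ l) ≡ + 0
  off′ p l p≢l with l ≟ i
  ... | yes refl = trans (cong (λ e → A p e + m p * A i e) (updateAt-updates i β)) (clears p p≢l)
  ... | no l≢i   = trans (unchanged p l l≢i) (off p l p≢l)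
  diag′ : ∀ l → shear i m A l (β′ l) ≢ + 0
  diag′ l eq with l ≟ i
  ... | no l≢i   = diag l (trans (sym (unchanged l l l≢i)) eq)
  ... | yes refl = Aij≢0 (trans (sym (trans (cong (λ e → A i e + m i * A i e) (updateAt-updates i β))
                     (trans (cong (λ z → A i j + z * A i j) mi≡0) (ℤₚ.+-identityʳ (A i j))))) eq)

-- Congruence modulo 2 stands for equality of supports: for entries 0, 1, -1 the two are the same,
-- but congruence is visibly preserved when both matrices are sheared with the same multipliers.
record Twins {r n} (A B : Mat r n) (β : Fin r → Fin n) : Set where
  field
    unimodularˡ : Unimodular A
    unimodularʳ : Unimodular B
    standardˡ   : Standard A β
    standardʳ   : Standard B β
    parity      : ∀ i j → ∃ λ k → A i j ≡ B i j + + 2 * k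

  tritˡ : ∀ i j → Trit (A i j)
  tritˡ = entry-trit unimodularˡ standardˡ

  tritʳ : ∀ i j → Trit (B i j)
  tritʳ = entry-trit unimodularʳ standardʳ

even-not-sign : ∀ k → ¬ IsSign (+ 2 * k)
even-not-sign k s with sign-factor (+ 2) k s
... | inj₁ ()
... | inj₂ ()

even-trit : ∀ {k z} → Trit z → + 2 * k ≡ z → z ≡ + 0
even-trit         (inj₁ z≡0) _  = z≡0
even-trit {k} {z} (inj₂ s)   eq = contradiction (subst IsSign (sym eq) s) (even-not-sign k)

twins-zeroʳ : ∀ {r n} {A B : Mat r n} {β} → Twins A B β → ∀ {i j} → A i j ≡ + 0 → B i j ≡ + 0
twins-zeroʳ {A = A} {B} tw {i} {j} Aij≡0 with k , eq ← Twins.parity tw i j =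
  even-trit {k = - k} (Twins.tritʳ tw i j) (trans (solve-for (B i j) k) (trans (cong (λ z → B i j + - z) (trans (sym eq) Aij≡0)) (ℤₚ.+-identityʳ _)))
  where
  solve-for : ∀ b k → + 2 * - k ≡ b + - (b + + 2 * k)
  solve-for = solve-∀

twins-zeroˡ : ∀ {r n} {A B : Mat r n} {β} → Twins A B β → ∀ {i j} → B i j ≡ + 0 → A i j ≡ + 0
twins-zeroˡ tw {i} {j} Bij≡0 with k , eq ← Twins.parity tw i j =
  even-trit {k} (Twins.tritˡ tw i j) (sym (trans eq (trans (cong (_+ + 2 * k) Bij≡0) (ℤₚ.+-identityˡ _))))

-- The multipliers that clear column `j` outside row `i`. The pivot `A i j` is a sign, hence its own
-- inverse, and a product takes the place of a quotient.
pivotRow : ∀ {r n} → Mat r n → Fin r → Fin n → Fin r → ℤ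
pivotRow A i j p with p ≟ i
... | yes _ = + 0
... | no  _ = - (A p j * A i j)

pivotRow-≡ : ∀ {r n} (A : Mat r n) i j → pivotRow A i j i ≡ + 0
pivotRow-≡ A i j with i ≟ i
... | yes _  = refl
... | no i≢i = contradiction refl i≢i

pivotRow-≢ : ∀ {r n} (A : Mat r n) i j {p} → p ≢ i → pivotRow A i j p ≡ - (A p j * A i j)
pivotRow-≢ A i j {p} p≢i with p ≟ i
... | yes p≡i = contradiction p≡i p≢i
... | no _    = refl

pivotRow-zero : ∀ {r n} (A : Mat r n) i j {p} → A p j ≡ + 0 → pivotRow A i j p ≡ + 0
pivotRow-zero A i j {p} Apj≡0 with p ≟ i
... | yes _ = refl
... | no _  = cong (λ z → - (z * A i j)) Apj≡0

-- Since `A` and `B` agree in column `j`, the multipliers computed from `A` clear that column in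
-- both matrices.
pivot-twins : ∀ {r n} {A B : Mat r n} {β} → Twins A B β → ∀ i j → (∀ p → A p j ≡ B p j) → A i j ≢ + 0 →
  Twins (shear i (pivotRow A i j) A) (shear i (pivotRow A i j) B) (updateAt β i (const j))
pivot-twins {A = A} {B} {β} tw i j agree Aij≢0 = record
  { unimodularˡ = shear-unimodular i m A (pivotRow-≡ A i j) unimodularˡ
  ; unimodularʳ = shear-unimodular i m B (pivotRow-≡ A i j) unimodularʳ
  ; standardˡ   = pivot-standard {A = A} {β} i j m (pivotRow-≡ A i j) Aij≢0 clears standardˡ
  ; standardʳ   = pivot-standard {A = B} {β} i j m (pivotRow-≡ A i j) (Aij≢0 ∘ trans (agree i))
                    (λ p p≢i → subst (_≡ + 0) (cong₂ (λ x y → x + m p * y) (agree p) (agree i)) (clears p p≢i)) standardʳ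
  ; parity      = λ p q → let k , eq = parity p q ; l , eq′ = parity i q in
                    k + m p * l , trans (cong₂ (λ x y → x + m p * y) eq eq′) (collect (B p q) k (m p) (B i q) l)
  }
  where
  open Twins tw
  m = pivotRow A i j
  collect : ∀ a k m b l → a + + 2 * k + m * (b + + 2 * l) ≡ a + m * b + + 2 * (k + m * l)
  collect = solve-∀
  regroup : ∀ x y → x + - (x * y) * y ≡ x + - (x * (y * y))
  regroup = solve-∀
  clears : ∀ p → p ≢ i → A p j + m p * A i j ≡ + 0
  clears p p≢i = trans (cong (λ z → A p j + z * A i j) (pivotRow-≢ A i j p≢i))
    (trans (regroup (A p j) (A i j))
    (trans (cong (λ z → A p j + - (A p j * z)) (sign-square (trit-≢0 (tritˡ i j) Aij≢0)))
    (trans (cong (λ z → A p j + - z) (ℤₚ.*-identityʳ (A p j))) (ℤₚ.+-inverseʳ (A p j)))))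

-- x and y odd makes x + y even, and 0 is the only even number among 0, 1, -1.
trit-sum : ∀ {x y} → IsSign x → IsSign y → Trit (x + y) → x ≡ - y
trit-sum (inj₁ refl) (inj₂ refl) _ = refl
trit-sum (inj₂ refl) (inj₁ refl) _ = refl
trit-sum (inj₁ refl) (inj₁ refl) (inj₁ ())
trit-sum (inj₁ refl) (inj₁ refl) (inj₂ (inj₁ ()))
trit-sum (inj₁ refl) (inj₁ refl) (inj₂ (inj₂ ()))
trit-sum (inj₂ refl) (inj₂ refl) (inj₁ ())
trit-sum (inj₂ refl) (inj₂ refl) (inj₂ (inj₁ ()))
trit-sum (inj₂ refl) (inj₂ refl) (inj₂ (inj₂ ()))

scaled-product : ∀ m a b → IsSign m → (m * a) * (m * b) ≡ a * b
scaled-product m a b s = trans (regroup m a b) (trans (cong (_* (a * b)) (sign-square s)) (ℤₚ.*-identityˡ (a * b)))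
  where
  regroup : ∀ m a b → (m * a) * (m * b) ≡ (m * m) * (a * b)
  regroup = solve-∀

module _ {r n} {A B : Mat r n} {β} (tw : Twins A B β) where
  open Twins tw

  pivotRow-sign : ∀ {i j p} → p ≢ i → A i j ≢ + 0 → A p j ≢ + 0 → IsSign (pivotRow A i j p)
  pivotRow-sign {i} {j} {p} p≢i Aij≢0 Apj≢0 = subst IsSign (sym (pivotRow-≢ A i j p≢i))
    (sign-neg (sign-* (trit-≢0 (tritˡ p j) Apj≢0) (trit-≢0 (tritˡ i j) Aij≢0)))

  -- Pivoting on `(i , j)` turns the entry at `(k , j₀)` into a sum of two signs, which must vanish
  -- because it is again 0, 1 or -1. So in both matrices the entry of row `k` is that of row `i`
  -- times one common sign. Ratios are written as products, signs being their own inverses.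
  ratio-adjacent : ∀ {i k} j j₀ → (∀ p → A p j ≡ B p j) → A i j ≢ + 0 → A k j ≢ + 0 →
    A i j₀ ≢ + 0 → A k j₀ ≢ + 0 → A i j₀ * B i j₀ ≡ A k j₀ * B k j₀
  ratio-adjacent {i} {k} j j₀ agree Aij≢0 Akj≢0 Aij₀≢0 Akj₀≢0 with k ≟ i
  ... | yes refl = refl
  ... | no k≢i   = sym (begin
    A k j₀ * B k j₀                    ≡⟨ cong₂ _*_
      (trit-sum (trit-≢0 (tritˡ k j₀) Akj₀≢0) (sign-* m-sign (trit-≢0 (tritˡ i j₀) Aij₀≢0)) (Twins.tritˡ tw′ k j₀))
      (trit-sum (trit-≢0 (tritʳ k j₀) (Akj₀≢0 ∘ twins-zeroˡ tw)) (sign-* m-sign (trit-≢0 (tritʳ i j₀) (Aij₀≢0 ∘ twins-zeroˡ tw)))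
        (Twins.tritʳ tw′ k j₀)) ⟩
    - (m * A i j₀) * - (m * B i j₀)    ≡⟨ negs (m * A i j₀) (m * B i j₀) ⟩
    (m * A i j₀) * (m * B i j₀)        ≡⟨ scaled-product m (A i j₀) (B i j₀) m-sign ⟩
    A i j₀ * B i j₀                    ∎)
    where
    open ≡-Reasoning
    m = pivotRow A i j k
    m-sign = pivotRow-sign k≢i Aij≢0 Akj≢0
    tw′ = pivot-twins tw i j agree Aij≢0
    negs : ∀ x y → - x * - y ≡ x * y
    negs = solve-∀

-- Walks between rows

Adj : ∀ {r n} → Mat r n → List (Fin n) → Fin r → Fin r → Set
Adj A js i k = ∃ λ j → j ∈ js × A i j ≢ + 0 × A k j ≢ + 0

Walk : ∀ {r n} → Mat r n → List (Fin n) → Fin r → Fin r → Set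
Walk A js = Star (Adj A js)

len : ∀ {r n} {A : Mat r n} {js i k} → Walk A js i k → ℕ
len ε       = 0
len (_ ◅ w) = suc (len w)

walk-sym : ∀ {r n} {A : Mat r n} {js i k} → Walk A js i k → Walk A js k i
walk-sym = Star.reverse λ { (j , j∈js , p , q) → j , j∈js , q , p }

-- Shearing along row i changes no column in which row i vanishes, so a walk whose columns all
-- avoid row i survives; otherwise row i can join the walk at the column it touches.
shortcut-or-shear : ∀ {r n} (A : Mat r n) js i m {k l} (w : Walk A js k l) →
  (∃ λ (w′ : Walk A js i l) → len w′ ℕ.≤ len w) ⊎ (∃ λ (w′ : Walk (shear i m A) js k l) → len w′ ℕ.≤ len w)
shortcut-or-shear A js i m ε = inj₂ (ε , ℕ.z≤n)
shortcut-or-shear A js i m ((j , j∈js , p , q) ◅ w) with A i j ℤₚ.≟ + 0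
... | no Aij≢0  = inj₁ ((j , j∈js , Aij≢0 , q) ◅ w , ℕₚ.≤-refl)
... | yes Aij≡0 with shortcut-or-shear A js i m w
... | inj₁ (w′ , le) = inj₁ (w′ , ℕₚ.m≤n⇒m≤1+n le)
... | inj₂ (w′ , le) = inj₂ ((j , j∈js , p ∘ trans (sym (same _)) , q ∘ trans (sym (same _))) ◅ w′ , ℕ.s≤s le)
  where
  same : ∀ p → shear i m A p j ≡ A p j
  same p = trans (cong (λ z → A p j + m p * z) Aij≡0) (trans (cong (_+_ (A p j)) (ℤₚ.*-zeroʳ (m p))) (ℤₚ.+-identityʳ _))

-- The induction is on a bound for the length, since the recursive calls concern new walks and,
-- after a pivot, new matrices and a new basis.
ratio-walk : ∀ N {r n} {A B : Mat r n} {β} → Twins A B β → ∀ js → (∀ {j} → j ∈ js → ∀ p → A p j ≡ B p j) → ∀ j₀ →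
  ∀ {i l} (w : Walk A js i l) → len w ℕ.≤ N → A i j₀ ≢ + 0 → A l j₀ ≢ + 0 → A i j₀ * B i j₀ ≡ A l j₀ * B l j₀
ratio-walk N tw js agree j₀ ε _ _ _ = refl
ratio-walk (suc N) {A = A} {B} tw js agree j₀ {i} {l} (_◅_ {j = k} (j , j∈js , Aij≢0 , Akj≢0) w) (ℕ.s≤s le) Aij₀≢0 Alj₀≢0
  with A k j₀ ℤₚ.≟ + 0 | A l j ℤₚ.≟ + 0 | shortcut-or-shear A js i (pivotRow A i j) w
-- Row `k` meets `j₀` too, so the ratio passes through it.
... | no Akj₀≢0 | _ | _ = trans (ratio-adjacent tw j j₀ (agree j∈js) Aij≢0 Akj≢0 Aij₀≢0 Akj₀≢0)
                            (ratio-walk N tw js agree j₀ w le Akj₀≢0 Alj₀≢0)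
-- Column `j` joins the two ends directly.
... | yes _ | no Alj≢0 | _ = ratio-adjacent tw j j₀ (agree j∈js) Aij≢0 Alj≢0 Aij₀≢0 Alj₀≢0
... | yes _ | yes _ | inj₁ (w′ , le′) = ratio-walk N tw js agree j₀ w′ (ℕₚ.≤-trans le′ le) Aij₀≢0 Alj₀≢0
-- After pivoting on `(i , j)`, the entry of row `k` in `j₀`, zero before, is that of row `i` times
-- a sign common to both matrices. Row `l` does not change because it vanishes in column `j`.
... | yes Akj₀≡0 | yes Alj≡0 | inj₂ (w′ , le′) = begin
  A i j₀ * B i j₀                                ≡⟨ scaled-product (m k) (A i j₀) (B i j₀) m-sign ⟨
  (m k * A i j₀) * (m k * B i j₀)                ≡⟨ cong₂ _*_ A′k B′k ⟨
  shear i m A k j₀ * shear i m B k j₀            ≡⟨ ratio-walk N (pivot-twins tw i j (agree j∈js) Aij≢0) js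
                                                      (λ {j} j∈js p → cong₂ (λ x y → x + m p * y) (agree j∈js p) (agree j∈js i))
                                                      j₀ w′ (ℕₚ.≤-trans le′ le)
                                                      (λ e → sign-≢0 (sign-* m-sign (trit-≢0 (tritˡ i j₀) Aij₀≢0)) (trans (sym A′k) e))
                                                      (λ e → Alj₀≢0 (trans (sym (fixed A)) e)) ⟩
  shear i m A l j₀ * shear i m B l j₀            ≡⟨ cong₂ _*_ (fixed A) (fixed B) ⟩
  A l j₀ * B l j₀                                ∎
  where
  open ≡-Reasoning
  open Twins tw
  m = pivotRow A i j
  m-sign : IsSign (m k)
  m-sign = pivotRow-sign tw (λ k≡i → Aij₀≢0 (subst (λ e → A e j₀ ≡ + 0) k≡i Akj₀≡0)) Aij≢0 Akj≢0
  A′k : shear i m A k j₀ ≡ m k * A i j₀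
  A′k = trans (cong (_+ m k * A i j₀) Akj₀≡0) (ℤₚ.+-identityˡ _)
  B′k : shear i m B k j₀ ≡ m k * B i j₀
  B′k = trans (cong (_+ m k * B i j₀) (twins-zeroʳ tw Akj₀≡0)) (ℤₚ.+-identityˡ _)
  fixed : ∀ X → shear i m X l j₀ ≡ X l j₀
  fixed X = trans (cong (λ z → X l j₀ + z * X i j₀) (pivotRow-zero A i j Alj≡0)) (ℤₚ.+-identityʳ _)

Hit : ∀ {r n} → Mat r n → List (Fin n) → Fin n → Fin r → Set
Hit A js j₀ i = ∃ λ p → A p j₀ ≢ + 0 × Walk A js p i

mutual
  -- Recursion on the list of columns: a walk that uses `j₀` amounts to walks, avoiding this
  -- occurrence of `j₀`, from each end to some row that meets `j₀`.
  walk? : ∀ {r n} (A : Mat r n) js i k → Dec (Walk A js i k)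
  walk? A [] i k with i ≟ k
  ... | yes refl = yes ε
  ... | no i≢k   = no λ { ε → i≢k refl ; ((_ , () , _) ◅ _) }
  walk? A (j₀ ∷ js) i k = map′ join split (walk? A js i k ⊎-dec (hit? A js j₀ i ×-dec hit? A js j₀ k))
    where
    widen : ∀ {i k} → Walk A js i k → Walk A (j₀ ∷ js) i k
    widen = Star.map λ { (j , j∈js , p , q) → j , there j∈js , p , q }
    join : Walk A js i k ⊎ (Hit A js j₀ i × Hit A js j₀ k) → Walk A (j₀ ∷ js) i k
    join (inj₁ w) = widen w
    join (inj₂ ((p , Ap≢0 , w) , (q , Aq≢0 , w′))) =
      walk-sym (widen w) ◅◅ (j₀ , here refl , Ap≢0 , Aq≢0) ◅ widen w′
    split : ∀ {i k} → Walk A (j₀ ∷ js) i k → Walk A js i k ⊎ (Hit A js j₀ i × Hit A js j₀ k)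
    split ε = inj₁ ε
    split ((j , here refl , p , q) ◅ w) with split w
    ... | inj₁ w′      = inj₂ ((_ , p , ε) , (_ , q , w′))
    ... | inj₂ (_ , h) = inj₂ ((_ , p , ε) , h)
    split ((j , there j∈js , p , q) ◅ w) with split w
    ... | inj₁ w′                  = inj₁ ((j , j∈js , p , q) ◅ w′)
    ... | inj₂ ((t , At , w′) , h) = inj₂ ((t , At , w′ ◅◅ (j , j∈js , q , p) ◅ ε) , h)

  hit? : ∀ {r n} (A : Mat r n) js j₀ i → Dec (Hit A js j₀ i)
  hit? A js j₀ i = any? λ p → ¬? (A p j₀ ℤₚ.≟ + 0) ×-dec walk? A js p i

-- Adjusting signs column by column

resign : ∀ {r n} → (Fin r → ℤ) → (Fin n → ℤ) → Mat r n → Mat r n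
resign d s B i j = d i * B i j * s j

resign-unimodular : ∀ {r n} {d : Fin r → ℤ} {s : Fin n → ℤ} → (∀ i → IsSign (d i)) → (∀ j → IsSign (s j)) →
  (B : Mat r n) → Unimodular B → Unimodular (resign d s B)
resign-unimodular {d = d} {s} d-sign s-sign B uB c triv = (λ l q → s (c l) * (R l q * d q)) , inverse
  where
  open ≡-Reasoning
  regroup : ∀ d b s x → d * b * s * (s * x) ≡ d * ((s * s) * (b * x))
  regroup = solve-∀
  pull : ∀ i (x : Fin _ → ℤ) → sumℤ (λ l → d i * B i (c l) * s (c l) * (s (c l) * x l)) ≡ d i * sumℤ (λ l → B i (c l) * x l)
  pull i x = trans (Σℤ.sum-cong (λ l → trans (regroup (d i) (B i (c l)) (s (c l)) (x l))
      (cong (d i *_) (trans (cong (_* (B i (c l) * x l)) (sign-square (s-sign (c l)))) (ℤₚ.*-identityˡ _)))))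
    (sym (Σℤ.*-sum (d i) (λ l → B i (c l) * x l)))
  invertible : RightInvertible (cols B c)
  invertible = uB c λ v Bv≡0 l → *-zero-factor (sign-≢0 (s-sign (c l)))
    (triv (λ l → s (c l) * v l) (λ i → trans (pull i v) (trans (cong (d i *_) (Bv≡0 i)) (ℤₚ.*-zeroʳ (d i)))) l)
  R = proj₁ invertible
  conj : ∀ i q → d i * (δ i q * d q) ≡ δ i q
  conj i q with i ≟ q
  ... | yes refl = trans (cong (λ z → d i * (z * d i)) (δ-refl i))
                     (trans (cong (d i *_) (ℤₚ.*-identityˡ (d i))) (trans (sign-square (d-sign i)) (sym (δ-refl i))))
  ... | no i≢q   = trans (cong (λ z → d i * (z * d q)) (δ-≢ i≢q)) (trans (ℤₚ.*-zeroʳ (d i)) (sym (δ-≢ i≢q)))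
  inverse : ∀ i q → sumℤ (λ l → d i * B i (c l) * s (c l) * (s (c l) * (R l q * d q))) ≡ δ i q
  inverse i q = begin
    sumℤ (λ l → d i * B i (c l) * s (c l) * (s (c l) * (R l q * d q)))
      ≡⟨ pull i (λ l → R l q * d q) ⟩
    d i * sumℤ (λ l → B i (c l) * (R l q * d q))
      ≡⟨ cong (d i *_) (trans (Σℤ.sum-cong (λ l → sym (ℤₚ.*-assoc (B i (c l)) (R l q) (d q)))) (sym (Σℤ.sum-* (d q) (λ l → B i (c l) * R l q)))) ⟩
    d i * ((cols B c ·ᴹ R) i q * d q)
      ≡⟨ cong (λ z → d i * (z * d q)) (proj₂ invertible i q) ⟩
    d i * (δ i q * d q)   ≡⟨ conj i q ⟩
    δ i q                 ∎

resign-twins : ∀ {r n} {A B : Mat r n} {β} {d s} → (∀ i → IsSign (d i)) → (∀ j → IsSign (s j)) →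
  Twins A B β → Twins A (resign d s B) β
resign-twins {A = A} {B} {β} {d} {s} d-sign s-sign tw = record
  { unimodularˡ = unimodularˡ
  ; unimodularʳ = resign-unimodular d-sign s-sign B unimodularʳ
  ; standardˡ   = standardˡ
  ; standardʳ   = (λ i l i≢l → trans (cong (λ z → d i * z * s (β l)) (proj₁ standardʳ i l i≢l))
                      (cong (_* s (β l)) (ℤₚ.*-zeroʳ (d i))))
                , (λ l e → proj₂ standardʳ l (*-zero-factor (sign-≢0 (d-sign l))
                      (*-zero-factor (sign-≢0 (s-sign (β l))) (trans (ℤₚ.*-comm (s (β l)) _) e))))
  ; parity      = λ i j → flip-sign (d i) (s j) (B i j) (sign-* (d-sign i) (s-sign j)) (parity i j)
  }
  where
  open Twins tw
  regroup : ∀ d b s → d * b * s ≡ (d * s) * b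
  regroup = solve-∀
  shifted : ∀ b k → b + + 2 * k ≡ - (+ 1) * b + + 2 * (b + k)
  shifted = solve-∀
  flip-sign : ∀ {a} d s b → IsSign (d * s) → (∃ λ k → a ≡ b + + 2 * k) → ∃ λ k → a ≡ d * b * s + + 2 * k
  flip-sign d s b (inj₁ ds≡1) (k , eq) = k , trans eq (cong (_+ + 2 * k)
    (sym (trans (regroup d b s) (trans (cong (_* b) ds≡1) (ℤₚ.*-identityˡ b)))))
  flip-sign d s b (inj₂ ds≡-1) (k , eq) = b + k , trans eq (trans (shifted b k) (cong (_+ + 2 * (b + k))
    (sym (trans (regroup d b s) (cong (_* b) ds≡-1)))))

-- The row sign is constant on each component of rows: it is the ratio in column `j₀` at a row of
-- the component that meets `j₀`, and 1 if there is none. Every earlier column lies within one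
-- component, so a column sign can undo the effect there.
module ExtendSigning {r n} {A B : Mat r n} {β} (tw : Twins A B β) (js : List (Fin n))
  (agree : ∀ {j} → j ∈ js → ∀ p → A p j ≡ B p j) (j₀ : Fin n) where
  open Twins tw

  rowValue : ∀ {i} → Dec (Hit A js j₀ i) → ℤ
  rowValue (yes (p , _)) = A p j₀ * B p j₀
  rowValue (no _)        = + 1

  rowSign : Fin r → ℤ
  rowSign i = rowValue (hit? A js j₀ i)

  rowSign-sign : ∀ i → IsSign (rowSign i)
  rowSign-sign i with hit? A js j₀ i
  ... | yes (p , Apj₀≢0 , _) = sign-* (trit-≢0 (tritˡ p j₀) Apj₀≢0) (trit-≢0 (tritʳ p j₀) (Apj₀≢0 ∘ twins-zeroˡ tw))
  ... | no _                 = inj₁ refl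

  -- By `ratio-walk` the value does not depend on which row `hit?` happens to find.
  rowSign-hit : ∀ {i l} → A i j₀ ≢ + 0 → Walk A js i l → rowSign l ≡ A i j₀ * B i j₀
  rowSign-hit {i} {l} Aij₀≢0 w with hit? A js j₀ l
  ... | no ¬hit              = contradiction (i , Aij₀≢0 , w) ¬hit
  ... | yes (p , Apj₀≢0 , w′) = ratio-walk _ tw js agree j₀ (w′ ◅◅ walk-sym w) ℕₚ.≤-refl Apj₀≢0 Aij₀≢0

  rowSign-walk : ∀ {i l} → Walk A js i l → rowSign i ≡ rowSign l
  rowSign-walk {i} {l} w = case-hit (hit? A js j₀ i) (hit? A js j₀ l)
    where
    case-hit : (di : Dec (Hit A js j₀ i)) (dl : Dec (Hit A js j₀ l)) → rowSign i ≡ rowSign l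
    case-hit (yes (p , Ap≢0 , w′)) _ = trans (rowSign-hit Ap≢0 w′) (sym (rowSign-hit Ap≢0 (w′ ◅◅ w)))
    case-hit (no ¬hit) (yes (p , Ap≢0 , w′)) = contradiction (p , Ap≢0 , w′ ◅◅ walk-sym w) ¬hit
    case-hit (no ¬hit) (no ¬hit′) = trans (unhit ¬hit) (sym (unhit ¬hit′))
      where
      unhit : ∀ {k} → ¬ Hit A js j₀ k → rowSign k ≡ + 1
      unhit {k} ¬h with hit? A js j₀ k
      ... | yes h = contradiction h ¬h
      ... | no _  = refl

  -- The row sign of any row that the column meets, so that the two cancel. The new column must keep
  -- the sign 1, because its row signs already correct it; a zero column gets 1 as a default.
  colSign : Fin n → ℤ
  colSign j with j ≟ j₀ | any? (λ i → ¬? (A i j ℤₚ.≟ + 0))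
  ... | no _ | yes (i , _) = rowSign i
  ... | _    | _           = + 1

  colSign-sign : ∀ j → IsSign (colSign j)
  colSign-sign j with j ≟ j₀ | any? (λ i → ¬? (A i j ℤₚ.≟ + 0))
  ... | yes _ | yes _       = inj₁ refl
  ... | yes _ | no _        = inj₁ refl
  ... | no _  | yes (i , _) = rowSign-sign i
  ... | no _  | no _        = inj₁ refl

  colSign-new : colSign j₀ ≡ + 1
  colSign-new with j₀ ≟ j₀ | any? (λ i → ¬? (A i j₀ ℤₚ.≟ + 0))
  ... | yes _     | yes _ = refl
  ... | yes _     | no _  = refl
  ... | no j₀≢j₀ | _     = contradiction refl j₀≢j₀

  colSign-old : ∀ {i j} → j ∈ js → j ≢ j₀ → A i j ≢ + 0 → colSign j ≡ rowSign i
  colSign-old {i} {j} j∈js j≢j₀ Aij≢0 with j ≟ j₀ | any? (λ i → ¬? (A i j ℤₚ.≟ + 0))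
  ... | yes j≡j₀ | _               = contradiction j≡j₀ j≢j₀
  ... | no _     | no ¬any         = contradiction (i , Aij≢0) ¬any
  ... | no _     | yes (p , Apj≢0) = rowSign-walk ((j , j∈js , Apj≢0 , Aij≢0) ◅ ε)

  extended-old : ∀ {j} → j ∈ js → j ≢ j₀ → ∀ i → A i j ≡ resign rowSign colSign B i j
  extended-old {j} j∈js j≢j₀ i with A i j ℤₚ.≟ + 0
  ... | yes Aij≡0 = trans Aij≡0 (sym (trans (cong (λ z → rowSign i * z * colSign j) (twins-zeroʳ tw Aij≡0))
                      (cong (_* colSign j) (ℤₚ.*-zeroʳ (rowSign i)))))
  ... | no Aij≢0  = sym (begin
    rowSign i * B i j * colSign j      ≡⟨ cong (rowSign i * B i j *_) (colSign-old j∈js j≢j₀ Aij≢0) ⟩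
    rowSign i * B i j * rowSign i      ≡⟨ regroup (rowSign i) (B i j) ⟩
    (rowSign i * rowSign i) * B i j    ≡⟨ cong (_* B i j) (sign-square (rowSign-sign i)) ⟩
    + 1 * B i j                        ≡⟨ ℤₚ.*-identityˡ (B i j) ⟩
    B i j                              ≡⟨ agree j∈js i ⟨
    A i j                              ∎)
    where
    open ≡-Reasoning
    regroup : ∀ e b → e * b * e ≡ (e * e) * b
    regroup = solve-∀

  extended-new : ∀ i → A i j₀ ≡ resign rowSign colSign B i j₀
  extended-new i with A i j₀ ℤₚ.≟ + 0
  ... | yes Aij≡0 = trans Aij≡0 (sym (trans (cong (λ z → rowSign i * z * colSign j₀) (twins-zeroʳ tw Aij≡0))
                      (cong (_* colSign j₀) (ℤₚ.*-zeroʳ (rowSign i)))))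
  ... | no Aij≢0  = sym (begin
    rowSign i * B i j₀ * colSign j₀     ≡⟨ cong₂ (λ x y → x * B i j₀ * y) (rowSign-hit Aij≢0 ε) colSign-new ⟩
    A i j₀ * B i j₀ * B i j₀ * + 1      ≡⟨ regroup (A i j₀) (B i j₀) ⟩
    (B i j₀ * B i j₀) * A i j₀          ≡⟨ cong (_* A i j₀) (sign-square (trit-≢0 (tritʳ i j₀) (Aij≢0 ∘ twins-zeroˡ tw))) ⟩
    + 1 * A i j₀                        ≡⟨ ℤₚ.*-identityˡ (A i j₀) ⟩
    A i j₀                              ∎)
    where
    open ≡-Reasoning
    regroup : ∀ a b → a * b * b * + 1 ≡ (b * b) * a
    regroup = solve-∀

Signing : ∀ {r n} → Mat r n → Mat r n → List (Fin n) → Set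
Signing {r} {n} A B js = ∃₂ λ (d : Fin r → ℤ) (s : Fin n → ℤ) → (∀ i → IsSign (d i)) × (∀ j → IsSign (s j)) ×
  (∀ {j} → j ∈ js → ∀ i → A i j ≡ resign d s B i j)

twins-signing : ∀ {r n} {A B : Mat r n} {β} → Twins A B β → ∀ js → Signing A B js
twins-signing tw [] = (λ _ → + 1) , (λ _ → + 1) , (λ _ → inj₁ refl) , (λ _ → inj₁ refl) , λ ()
twins-signing {A = A} {B} tw (j₀ ∷ js) with d , s , d-sign , s-sign , agree ← twins-signing tw js =
  (λ i → rowSign i * d i) , (λ j → s j * colSign j) ,
  (λ i → sign-* (rowSign-sign i) (d-sign i)) , (λ j → sign-* (s-sign j) (colSign-sign j)) ,
  λ {j} j∈ i → trans (extended j∈ i) (regroup (rowSign i) (d i) (B i j) (s j) (colSign j))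
  where
  open ExtendSigning (resign-twins d-sign s-sign tw) js agree j₀
  regroup : ∀ e d b s f → e * (d * b * s) * f ≡ e * d * b * (s * f)
  regroup = solve-∀
  extended : ∀ {j} → j ∈ j₀ ∷ js → ∀ i → A i j ≡ resign rowSign colSign (resign d s B) i j
  extended {j} j∈ i = go (j ≟ j₀) j∈
    where
    -- The decision on `j ≟ j₀` comes first: should `j₀` recur in `js`, it is to be treated as the
    -- new column.
    go : Dec (j ≡ j₀) → j ∈ j₀ ∷ js → A i j ≡ resign rowSign colSign (resign d s B) i j
    go (yes refl) _            = extended-new i
    go (no j≢j₀)  (here j≡j₀)  = contradiction j≡j₀ j≢j₀
    go (no j≢j₀)  (there j∈js) = extended-old j∈js j≢j₀ i

-- Uniqueness of unimodular representations

toℚᵘ-toℚ : ∀ z → ℚ.toℚᵘ (toℚ z) ℚᵘ.≃ mkℚᵘ z 0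
toℚᵘ-toℚ z = ℚₚ.toℚᵘ-fromℚᵘ (mkℚᵘ z 0)

toℚ-+ : ∀ x y → toℚ (x + y) ≡ toℚ x ℚ.+ toℚ y
toℚ-+ x y = ℚₚ.toℚᵘ-injective (ℚᵘₚ.≃-trans (toℚᵘ-toℚ (x + y)) (ℚᵘₚ.≃-trans (*≡* (identity₁ x y))
  (ℚᵘₚ.≃-trans (ℚᵘₚ.+-cong (ℚᵘₚ.≃-sym (toℚᵘ-toℚ x)) (ℚᵘₚ.≃-sym (toℚᵘ-toℚ y))) (ℚᵘₚ.≃-sym (ℚₚ.toℚᵘ-homo-+ (toℚ x) (toℚ y))))))
  where
  identity₁ : ∀ x y → (x + y) * + 1 ≡ (x * + 1 + y * + 1) * + 1
  identity₁ = solve-∀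

toℚ-* : ∀ x y → toℚ (x * y) ≡ toℚ x ℚ.* toℚ y
toℚ-* x y = ℚₚ.toℚᵘ-injective (ℚᵘₚ.≃-trans (toℚᵘ-toℚ (x * y))
  (ℚᵘₚ.≃-trans (ℚᵘₚ.*-cong (ℚᵘₚ.≃-sym (toℚᵘ-toℚ x)) (ℚᵘₚ.≃-sym (toℚᵘ-toℚ y))) (ℚᵘₚ.≃-sym (ℚₚ.toℚᵘ-homo-* (toℚ x) (toℚ y)))))

toℚ-zero : ∀ {z} → toℚ z ≡ 0ℚ → z ≡ + 0
toℚ-zero {z} eq with ℚᵘₚ.≃-trans (ℚᵘₚ.≃-sym (toℚᵘ-toℚ z)) (ℚᵘₚ.≃-reflexive (cong ℚ.toℚᵘ eq))
... | *≡* z*1≡0 = trans (sym (ℤₚ.*-identityʳ z)) z*1≡0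

toℚ-sum : ∀ {n} (f : Fin n → ℤ) → toℚ (sumℤ f) ≡ sumℚ (λ i → toℚ (f i))
toℚ-sum {zero}  f = refl
toℚ-sum {suc n} f = trans (toℚ-+ (f zero) (sumℤ (f ∘ suc))) (cong (toℚ (f zero) ℚ.+_) (toℚ-sum (f ∘ suc)))

toℚ-sum-* : ∀ {n} (f g : Fin n → ℤ) → toℚ (sumℤ (λ i → f i * g i)) ≡ sumℚ (λ i → toℚ (f i) ℚ.* toℚ (g i))
toℚ-sum-* f g = trans (toℚ-sum (λ i → f i * g i)) (Σℚ.sum-cong (λ i → toℚ-* (f i) (g i)))

*-toℚ-zero : ∀ {x z} → z ≢ + 0 → x ℚ.* toℚ z ≡ 0ℚ → x ≡ 0ℚ
*-toℚ-zero {x} {z} z≢0 xz≡0 = begin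
  x                                ≡⟨ ℚₚ.*-identityʳ x ⟨
  x ℚ.* 1ℚ                         ≡⟨ cong (x ℚ.*_) (ℚₚ.*-inverseʳ (toℚ z)) ⟨
  x ℚ.* (toℚ z ℚ.* ℚ.1/ toℚ z)     ≡⟨ ℚₚ.*-assoc x (toℚ z) (ℚ.1/ toℚ z) ⟨
  x ℚ.* toℚ z ℚ.* ℚ.1/ toℚ z       ≡⟨ cong (ℚ._* ℚ.1/ toℚ z) xz≡0 ⟩
  0ℚ ℚ.* ℚ.1/ toℚ z                ≡⟨ ℚₚ.*-zeroˡ (ℚ.1/ toℚ z) ⟩
  0ℚ                               ∎
  where
  open ≡-Reasoning
  instance z-nonZero : ℚ.NonZero (toℚ z)
           z-nonZero = ℚ.≢-nonZero (z≢0 ∘ toℚ-zero)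

combo-toℚ : ∀ {r n} (M : Mat r n) w i → combo M (toℚ ∘ w) i ≡ toℚ ((M ·ⱽ w) i)
combo-toℚ M w i = trans (Σℚ.sum-cong (λ j → ℚₚ.*-comm (toℚ (w j)) (toℚ (M i j)))) (sym (toℚ-sum-* (M i) w))

combo-· : ∀ {r k n} {P : Mat r k} {Z : Mat k n} {Y : Mat r n} → Y ≋ P ·ᴹ Z → ∀ a i →
  combo Y a i ≡ sumℚ (λ l → toℚ (P i l) ℚ.* combo Z a l)
combo-· {P = P} {Z} {Y} Y≋PZ a i = begin
  combo Y a i
    ≡⟨ Σℚ.sum-cong (λ j → trans (cong (λ z → a j ℚ.* toℚ z) (Y≋PZ i j)) (trans (ℚₚ.*-comm (a j) _)
         (cong (ℚ._* a j) (toℚ-sum-* (P i) (λ l → Z l j))))) ⟩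
  sumℚ (λ j → sumℚ (λ l → toℚ (P i l) ℚ.* toℚ (Z l j)) ℚ.* a j)
    ≡⟨ Σℚ.sum-assoc (λ l → toℚ (P i l)) (λ l j → toℚ (Z l j)) a ⟩
  sumℚ (λ l → toℚ (P i l) ℚ.* sumℚ (λ j → toℚ (Z l j) ℚ.* a j))
    ≡⟨ Σℚ.sum-cong (λ l → cong (toℚ (P i l) ℚ.*_) (Σℚ.sum-cong (λ j → ℚₚ.*-comm (toℚ (Z l j)) (a j)))) ⟩
  sumℚ (λ l → toℚ (P i l) ℚ.* combo Z a l) ∎
  where open ≡-Reasoning

-- Every relation among the columns of `Z` is one among those of `P Z`. Used for a factorisation in
-- each direction, this shows that a standard form has the same independent sets.
indep-· : ∀ {r k n} {P : Mat r k} {Z : Mat k n} {Y : Mat r n} {S : Fin n → Set} → Y ≋ P ·ᴹ Z →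
  ColsIndep Y S → ColsIndep Z S
indep-· {P = P} {Z} {Y} Y≋PZ indep a supp Za≡0 = indep a supp λ i → trans (combo-· {P = P} {Z} {Y} Y≋PZ a i)
  (Σℚ.sum-zero λ l → trans (cong (toℚ (P i l) ℚ.*_) (Za≡0 l)) (ℚₚ.*-zeroʳ (toℚ (P i l))))

combo-permute : ∀ {r n} (M : Mat r n) (σ : Permutation′ n) (a : Fin n → ℚ) i →
  combo M a i ≡ combo (cols M (σ ⟨$⟩ʳ_)) (λ e → a (σ ⟨$⟩ʳ e)) i
combo-permute M σ a i = Σℚ.sum-permute (λ j → a j ℚ.* toℚ (M i j)) σ

-- Absorbs the isomorphism of matroids into the order of the columns, so that both representations
-- become indexed by the ground set itself.
indep-permute : ∀ {r n} (M : Mat r n) (σ : Permutation′ n) (S : Fin n → Set) →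
  ColsIndep M (λ j → S (σ ⟨$⟩ˡ j)) ⇔ ColsIndep (cols M (σ ⟨$⟩ʳ_)) S
indep-permute M σ S = mk⇔ to from
  where
  to : ColsIndep M (λ j → S (σ ⟨$⟩ˡ j)) → ColsIndep (cols M (σ ⟨$⟩ʳ_)) S
  to indep a supp Na≡0 e Se = trans (cong a (sym (Perm.inverseˡ σ)))
    (indep (λ j → a (σ ⟨$⟩ˡ j)) (λ j → supp (σ ⟨$⟩ˡ j))
      (λ i → trans (combo-permute M σ (λ j → a (σ ⟨$⟩ˡ j)) i)
        (trans (Σℚ.sum-cong (λ e → cong (λ z → a z ℚ.* toℚ (M i (σ ⟨$⟩ʳ e))) (Perm.inverseˡ σ))) (Na≡0 i)))
      (σ ⟨$⟩ʳ e) (subst S (sym (Perm.inverseˡ σ)) Se))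
  from : ColsIndep (cols M (σ ⟨$⟩ʳ_)) S → ColsIndep M (λ j → S (σ ⟨$⟩ˡ j))
  from indep a supp Ma≡0 j Sj = trans (cong a (sym (Perm.inverseʳ σ)))
    (indep (λ e → a (σ ⟨$⟩ʳ e)) (λ e ¬Se → supp (σ ⟨$⟩ʳ e) (¬Se ∘ subst S (Perm.inverseˡ σ)))
      (λ i → trans (sym (combo-permute M σ a i)) (Ma≡0 i)) (σ ⟨$⟩ˡ j) Sj)

selector : ∀ {n k} → (Fin k → Fin n) → Mat n k
selector c e l = δ e (c l)

·-selector : ∀ {r n k} (M : Mat r n) (c : Fin k → Fin n) → M ·ᴹ selector c ≋ cols M c
·-selector M c i l = sum-δʳ (c l) (M i)

-- An integer kernel vector of the chosen columns, placed at their indices and extended by zero, is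
-- a rational relation supported in `S`. Injectivity of `c` lets its coefficients be read off again.
indep⇒trivialKernel : ∀ {r n k} (M : Mat r n) {S : Fin n → Set} (c : Fin k → Fin n) →
  Injective _≡_ _≡_ c → (∀ l → S (c l)) → ColsIndep M S → TrivialKernel (cols M c)
indep⇒trivialKernel M {S} c c-inj c∈S indep v Mcv≡0 l =
  trans (sym (at-c l)) (toℚ-zero (indep (toℚ ∘ w) supp kills (c l) (c∈S l)))
  where
  w = selector c ·ⱽ v
  at-c : ∀ l → w (c l) ≡ v l
  at-c l = trans (Σℤ.sum-single l (λ k k≢l → cong (_* v k) (δ-≢ (λ e → k≢l (sym (c-inj e))))))
    (trans (cong (_* v l) (δ-refl (c l))) (ℤₚ.*-identityˡ (v l)))
  supp : ∀ e → ¬ S e → toℚ (w e) ≡ 0ℚ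
  supp e ¬Se = cong toℚ (Σℤ.sum-zero λ k → cong (_* v k) (δ-≢ λ e≡ck → ¬Se (subst S (sym e≡ck) (c∈S k))))
  kills : ∀ i → combo M (toℚ ∘ w) i ≡ 0ℚ
  kills i = trans (combo-toℚ M w i) (cong toℚ (trans (sym (·ⱽ-assoc M (selector c) v i))
    (trans (Σℤ.sum-cong (λ k → cong (_* v k) (·-selector M c i k))) (Mcv≡0 i))))

enumerate : ∀ {n} (S : Subset n) → ∃ λ (c : Fin ∣ S ∣ → Fin n) → Injective _≡_ _≡_ c × (∀ l → c l ∈ˢ S)
enumerate [] = (λ ()) , (λ { {()} }) , λ ()
enumerate (outside ∷ S) with c , c-inj , c∈S ← enumerate S =
  suc ∘ c , c-inj ∘ suc-injective , Vec.there ∘ c∈S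
enumerate (inside ∷ S) with c , c-inj , c∈S ← enumerate S = c′ , c′-inj , c′∈S
  where
  c′ : Fin (suc ∣ S ∣) → Fin _
  c′ zero    = zero
  c′ (suc l) = suc (c l)
  c′-inj : Injective _≡_ _≡_ c′
  c′-inj {zero}  {zero}  _  = refl
  c′-inj {suc a} {suc b} eq = cong suc (c-inj (suc-injective eq))
  c′∈S : ∀ l → c′ l ∈ˢ inside ∷ S
  c′∈S zero    = Vec.here
  c′∈S (suc l) = Vec.there (c∈S l)

subset : ∀ {n} {P : Fin n → Set} → (∀ e → Dec (P e)) → Subset n
subset P? = tabulate (λ e → does (P? e))

∈-subset : ∀ {n} {P : Fin n → Set} (P? : ∀ e → Dec (P e)) {e} → P e → e ∈ˢ subset P?
∈-subset P? {e} Pe = lookup⇒[]= e _ (trans (lookup∘tabulate _ e) (dec-true (P? e) Pe))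

subset-∈ : ∀ {n} {P : Fin n → Set} (P? : ∀ e → Dec (P e)) {e} → e ∈ˢ subset P? → P e
subset-∈ P? {e} e∈ with P? e | trans (sym (lookup∘tabulate (λ e → does (P? e)) e)) ([]=⇒lookup e∈)
... | yes Pe | _ = Pe
... | no _   | ()

-- `C (D C - 1) = (C D) C - C = 0`, and the trivial kernel of `C` kills each column of `D C - 1`.
leftInverse : ∀ {r} (C D : Mat r r) → TrivialKernel C → C ·ᴹ D ≋ δ → D ·ᴹ C ≋ δ
leftInverse C D triv CD≋1 l q = trans (regroup _ _) (trans (cong (_+ δ l q) (triv v kills l)) (ℤₚ.+-identityˡ _))
  where
  open ≡-Reasoning
  v = λ l → (D ·ᴹ C) l q + - δ l q
  regroup : ∀ x y → x ≡ (x + - y) + y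
  regroup = solve-∀
  split : ∀ c x y → c * (x + - y) ≡ c * x + - c * y
  split = solve-∀
  kills : ∀ i → (C ·ⱽ v) i ≡ + 0
  kills i = begin
    (C ·ⱽ v) i
      ≡⟨ Σℤ.sum-cong (λ k → split (C i k) ((D ·ᴹ C) k q) (δ k q)) ⟩
    sumℤ (λ k → C i k * (D ·ᴹ C) k q + - C i k * δ k q)
      ≡⟨ Σℤ.sum-+ (λ k → C i k * (D ·ᴹ C) k q) (λ k → - C i k * δ k q) ⟩
    (C ·ᴹ (D ·ᴹ C)) i q + sumℤ (λ k → - C i k * δ k q)
      ≡⟨ cong₂ _+_ (trans (sym (·-assoc C D C i q)) (trans (·-congʳ C CD≋1 i q) (·-identityˡ C i q)))
           (sum-δʳ q (λ k → - C i k)) ⟩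
    C i q + - C i q
      ≡⟨ ℤₚ.+-inverseʳ (C i q) ⟩
    + 0 ∎

-- The basis `c` with `c i` exchanged for `j`. Its independence detects whether entry `(i , j)` of a
-- standard form vanishes, and this is how the matroid determines the support.
module Exchange {r n} (c : Fin r → Fin n) (i : Fin r) (j : Fin n) where

  Exchanged : Fin n → Set
  Exchanged e = (e ≡ j) ⊎ (∃ λ l → l ≢ i × e ≡ c l)

  exchanged? : ∀ e → Dec (Exchanged e)
  exchanged? e = (e ≟ j) ⊎-dec any? (λ l → ¬? (l ≟ i) ×-dec (e ≟ c l))

  -- In row `i` the only exchanged column with a nonzero entry is `j`, so its coefficient is zero;
  -- row `l` then isolates the coefficient of `c l`.
  exchange-indep : ∀ {Y : Mat r n} → cols Y c ≋ δ → Y i j ≢ + 0 → ColsIndep Y (_∈ˢ subset exchanged?)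
  exchange-indep {Y} Yc≋1 Yij≢0 a supp Ya≡0 e e∈ = on-T (subset-∈ exchanged? e∈)
    where
    term-zero : ∀ {p e} → Y p e ≡ + 0 → a e ℚ.* toℚ (Y p e) ≡ 0ℚ
    term-zero {p} {e} eq = trans (cong (λ z → a e ℚ.* toℚ z) eq) (ℚₚ.*-zeroʳ (a e))
    outside-T : ∀ p {e} → ¬ Exchanged e → a e ℚ.* toℚ (Y p e) ≡ 0ℚ
    outside-T p {e} ¬T = trans (cong (ℚ._* toℚ (Y p e)) (supp e (¬T ∘ subset-∈ exchanged?))) (ℚₚ.*-zeroˡ (toℚ (Y p e)))
    aj≡0 : a j ≡ 0ℚ
    aj≡0 = *-toℚ-zero Yij≢0 (trans (sym (Σℚ.sum-single j others)) (Ya≡0 i))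
      where
      others : ∀ e → e ≢ j → a e ℚ.* toℚ (Y i e) ≡ 0ℚ
      others e e≢j with exchanged? e
      ... | no ¬T                           = outside-T i ¬T
      ... | yes (inj₁ e≡j)                  = contradiction e≡j e≢j
      ... | yes (inj₂ (l , l≢i , refl))     = term-zero (trans (Yc≋1 i l) (δ-≢ (l≢i ∘ sym)))
    on-T : Exchanged e → a e ≡ 0ℚ
    on-T (inj₁ refl) = aj≡0
    on-T (inj₂ (l , l≢i , refl)) = *-toℚ-zero (λ eq → contradiction (trans (sym (trans (Yc≋1 l l) (δ-refl l))) eq) λ ())
      (trans (sym (Σℚ.sum-single (c l) others)) (Ya≡0 l))
      where
      others : ∀ e → e ≢ c l → a e ℚ.* toℚ (Y l e) ≡ 0ℚ
      others e e≢cl with exchanged? e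
      ... | no ¬T                     = outside-T l ¬T
      ... | yes (inj₁ refl)           = trans (cong (ℚ._* toℚ (Y l j)) aj≡0) (ℚₚ.*-zeroˡ (toℚ (Y l j)))
      ... | yes (inj₂ (k , _ , refl)) = term-zero (trans (Yc≋1 l k) (δ-≢ (λ l≡k → e≢cl (cong c (sym l≡k)))))

  -- Column `j` is the combination of the basis columns with its own entries as coefficients. Since
  -- `X i j` vanishes, `c i` does not occur, and `w` records this relation.
  exchange-dep : ∀ {X : Mat r n} → cols X c ≋ δ → (∀ l → j ≢ c l) → X i j ≡ + 0 →
    ¬ ColsIndep X (_∈ˢ subset exchanged?)
  exchange-dep {X} Xc≋1 j∉c Xij≡0 indep =
    contradiction (trans (sym wj≡1) (toℚ-zero (indep (toℚ ∘ w) supp kills j (∈-subset exchanged? (inj₁ refl))))) λ ()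
    where
    open ≡-Reasoning
    u = λ l → - X l j
    w = λ e → δ e j + (selector c ·ⱽ u) e
    wj≡1 : w j ≡ + 1
    wj≡1 = cong₂ _+_ (δ-refl j) (Σℤ.sum-zero (λ l → cong (_* u l) (δ-≢ (j∉c l))))
    supp : ∀ e → ¬ (e ∈ˢ subset exchanged?) → toℚ (w e) ≡ 0ℚ
    supp e e∉ = cong toℚ (cong₂ _+_ (δ-≢ (λ e≡j → e∉ (∈-subset exchanged? (inj₁ e≡j)))) (Σℤ.sum-zero term))
      where
      term : ∀ l → δ e (c l) * u l ≡ + 0
      term l with l ≟ i
      ... | yes refl = trans (cong (λ z → δ e (c i) * - z) Xij≡0) (ℤₚ.*-zeroʳ (δ e (c i)))
      ... | no l≢i   = cong (_* u l) (δ-≢ (λ e≡cl → e∉ (∈-subset exchanged? (inj₂ (l , l≢i , e≡cl)))))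
    kills : ∀ p → combo X (toℚ ∘ w) p ≡ 0ℚ
    kills p = trans (combo-toℚ X w p) (cong toℚ (begin
      (X ·ⱽ w) p
        ≡⟨ Σℤ.sum-cong (λ e → ℤₚ.*-distribˡ-+ (X p e) (δ e j) ((selector c ·ⱽ u) e)) ⟩
      sumℤ (λ e → X p e * δ e j + X p e * (selector c ·ⱽ u) e)
        ≡⟨ Σℤ.sum-+ (λ e → X p e * δ e j) (λ e → X p e * (selector c ·ⱽ u) e) ⟩
      sumℤ (λ e → X p e * δ e j) + (X ·ⱽ (selector c ·ⱽ u)) p
        ≡⟨ cong₂ _+_ (sum-δʳ j (X p)) (trans (sym (·ⱽ-assoc X (selector c) u p))
             (trans (Σℤ.sum-cong (λ l → cong (_* u l) (trans (·-selector X c p l) (Xc≋1 p l)))) (sum-δ p u))) ⟩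
      X p j + - X p j
        ≡⟨ ℤₚ.+-inverseʳ (X p j) ⟩
      + 0 ∎))

support-⊆ : ∀ {r n} {X Y : Mat r n} (c : Fin r → Fin n) → cols X c ≋ δ → cols Y c ≋ δ →
  (∀ (T : Subset n) → ColsIndep Y (_∈ˢ T) → ColsIndep X (_∈ˢ T)) → ∀ i j → X i j ≡ + 0 → Y i j ≡ + 0
support-⊆ {X = X} {Y} c Xc≋1 Yc≋1 Y⇒X i j Xij≡0 with any? (λ l → j ≟ c l)
... | yes (l , refl) = trans (Yc≋1 i l) (trans (sym (Xc≋1 i l)) Xij≡0)
... | no j∉c with Y i j ℤₚ.≟ + 0
... | yes Yij≡0 = Yij≡0
... | no Yij≢0  = contradiction (Y⇒X _ (exchange-indep {Y} Yc≋1 Yij≢0))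
                    (exchange-dep {X} Xc≋1 (λ l j≡cl → j∉c (l , j≡cl)) Xij≡0)
  where open Exchange c i j

trit-parity : ∀ {x y} → Trit x → Trit y → (x ≡ + 0 → y ≡ + 0) → (y ≡ + 0 → x ≡ + 0) → ∃ λ k → x ≡ y + + 2 * k
trit-parity {x} {y} tx ty x⇒y y⇒x with x ℤₚ.≟ + 0
... | yes x≡0 = + 0 , trans x≡0 (sym (trans (ℤₚ.+-identityʳ y) (x⇒y x≡0)))
... | no x≢0  = go (trit-≢0 tx x≢0) (trit-≢0 ty (x≢0 ∘ y⇒x))
  where
  go : ∀ {x y} → IsSign x → IsSign y → ∃ λ k → x ≡ y + + 2 * k
  go (inj₁ refl) (inj₁ refl) = + 0 , refl
  go (inj₁ refl) (inj₂ refl) = + 1 , refl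
  go (inj₂ refl) (inj₁ refl) = - (+ 1) , refl
  go (inj₂ refl) (inj₂ refl) = + 0 , refl

-- Both inverse laws serve: `DC≋1` makes the basis columns of `X` the identity, and `CD≋1` recovers
-- `N` from `X`.
record StandardForm {r n} (N : Mat r n) (c : Fin r → Fin n) : Set where
  field
    D    : Mat r r
    CD≋1 : cols N c ·ᴹ D ≋ δ
    DC≋1 : D ·ᴹ cols N c ≋ δ

  X : Mat r n
  X = D ·ᴹ N

  factor : N ≋ cols N c ·ᴹ X
  factor = ≋-trans (≋-sym (·-identityˡ N)) (≋-trans (·-congʳ N (≋-sym CD≋1)) (·-assoc (cols N c) D N))

  X-standard : Standard X c
  X-standard = (λ i l i≢l → trans (DC≋1 i l) (δ-≢ i≢l)) ,
    λ l eq → contradiction (trans (sym (trans (DC≋1 l l) (δ-refl l))) eq) λ ()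

standardForm : ∀ {r n} (N : Mat r n) c → Unimodular N → TrivialKernel (cols N c) → StandardForm N c
standardForm N c uN triv with D , CD≋1 ← uN c triv =
  record { D = D ; CD≋1 = CD≋1 ; DC≋1 = leftInverse (cols N c) D triv CD≋1 }

scaleRows : ∀ {r n} → (Fin r → ℤ) → Mat r n → Mat r n
scaleRows d A i j = d i * A i j

scaleRows-· : ∀ {r k n} d (A : Mat r k) (B : Mat k n) → scaleRows d A ·ᴹ B ≋ scaleRows d (A ·ᴹ B)
scaleRows-· d A B i j = trans (Σℤ.sum-cong (λ l → ℤₚ.*-assoc (d i) (A i l) (B l j))) (sym (Σℤ.*-sum (d i) (λ l → A i l * B l j)))

sign-cancel : ∀ {d} x → IsSign d → d * (d * x) ≡ x
sign-cancel {d} x s = trans (sym (ℤₚ.*-assoc d d x)) (trans (cong (_* x) (sign-square s)) (ℤₚ.*-identityˡ x))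

scaled-inverse : ∀ {r} {d : Fin r → ℤ} {C₁ D₁ C₂ D₂ : Mat r r} → (∀ i → IsSign (d i)) → D₁ ·ᴹ C₁ ≋ δ → C₂ ·ᴹ D₂ ≋ δ →
  (C₂ ·ᴹ scaleRows d D₁) ·ᴹ (C₁ ·ᴹ scaleRows d D₂) ≋ δ
scaled-inverse {d = d} {C₁} {D₁} {C₂} {D₂} d-sign D₁C₁≋1 C₂D₂≋1 =
  ≋-trans (·-assoc C₂ (scaleRows d D₁) (C₁ ·ᴹ scaleRows d D₂))
  (≋-trans (·-congˡ C₂ middle) C₂D₂≋1)
  where
  middle : scaleRows d D₁ ·ᴹ (C₁ ·ᴹ scaleRows d D₂) ≋ D₂
  middle i j = trans (scaleRows-· d D₁ (C₁ ·ᴹ scaleRows d D₂) i j)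
    (trans (cong (d i *_) (trans (sym (·-assoc D₁ C₁ (scaleRows d D₂) i j))
      (trans (·-congʳ (scaleRows d D₂) D₁C₁≋1 i j) (·-identityˡ (scaleRows d D₂) i j))))
    (sign-cancel (D₂ i j) (d-sign i)))

UnimodularlyEquivalent : ∀ {r n} → Mat r n → Mat r n → Set
UnimodularlyEquivalent {r} {n} N₁ N₂ = ∃₂ λ (F G : Mat r r) → ∃ λ (s : Fin n → ℤ) →
  (F ·ᴹ G ≋ δ) × (G ·ᴹ F ≋ δ) × (∀ e → IsSign (s e)) × (∀ i e → N₂ i e ≡ (F ·ᴹ N₁) i e * s e)

-- Equal independent sets give the two standard forms equal supports, so they are twins and differ
-- by signs; undoing the two changes of basis compares the original matrices.
unique-representation : ∀ {r n} {N₁ N₂ : Mat r n} {c : Fin r → Fin n} → Unimodular N₁ → Unimodular N₂ →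
  TrivialKernel (cols N₁ c) → TrivialKernel (cols N₂ c) →
  (∀ (T : Subset n) → ColsIndep N₁ (_∈ˢ T) ⇔ ColsIndep N₂ (_∈ˢ T)) → UnimodularlyEquivalent N₁ N₂
unique-representation {r} {n} {N₁} {N₂} {c} u₁ u₂ triv₁ triv₂ same = go (twins-signing twins (allFin n))
  where
  module S₁ = StandardForm (standardForm N₁ c u₁ triv₁)
  module S₂ = StandardForm (standardForm N₂ c u₂ triv₂)
  C₁ = cols N₁ c
  C₂ = cols N₂ c
  uX₁ : Unimodular S₁.X
  uX₁ = unimodular-· {P = S₁.D} {C₁} {N₁} S₁.DC≋1 (λ _ _ → refl) u₁
  uX₂ : Unimodular S₂.X
  uX₂ = unimodular-· {P = S₂.D} {C₂} {N₂} S₂.DC≋1 (λ _ _ → refl) u₂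
  X₁⇒N₁ : ∀ {S : Fin n → Set} → ColsIndep S₁.X S → ColsIndep N₁ S
  X₁⇒N₁ = indep-· {P = S₁.D} {N₁} {S₁.X} (λ _ _ → refl)
  X₂⇒N₂ : ∀ {S : Fin n → Set} → ColsIndep S₂.X S → ColsIndep N₂ S
  X₂⇒N₂ = indep-· {P = S₂.D} {N₂} {S₂.X} (λ _ _ → refl)
  N₁⇒X₁ : ∀ {S : Fin n → Set} → ColsIndep N₁ S → ColsIndep S₁.X S
  N₁⇒X₁ = indep-· {P = C₁} {S₁.X} {N₁} S₁.factor
  N₂⇒X₂ : ∀ {S : Fin n → Set} → ColsIndep N₂ S → ColsIndep S₂.X S
  N₂⇒X₂ = indep-· {P = C₂} {S₂.X} {N₂} S₂.factor
  zero₁₂ = support-⊆ {X = S₁.X} {S₂.X} c S₁.DC≋1 S₂.DC≋1 (λ T i → N₁⇒X₁ (Equivalence.from (same T) (X₂⇒N₂ i)))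
  zero₂₁ = support-⊆ {X = S₂.X} {S₁.X} c S₂.DC≋1 S₁.DC≋1 (λ T i → N₂⇒X₂ (Equivalence.to (same T) (X₁⇒N₁ i)))
  twins : Twins S₁.X S₂.X c
  twins = record
    { unimodularˡ = uX₁ ; unimodularʳ = uX₂ ; standardˡ = S₁.X-standard ; standardʳ = S₂.X-standard
    ; parity = λ i j → trit-parity
        (entry-trit {A = S₁.X} {c} uX₁ S₁.X-standard i j) (entry-trit {A = S₂.X} {c} uX₂ S₂.X-standard i j) (zero₁₂ i j) (zero₂₁ i j) }
  go : Signing S₁.X S₂.X (allFin n) → UnimodularlyEquivalent N₁ N₂
  go (d , s , d-sign , s-sign , X₁≡) =
    -- As `X₂` is `X₁` with signed rows and columns, `N₂ = C₂ X₂` equals `C₂ d D₁ N₁` up to column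
    -- signs. The inverse exchanges the two indices, `d` being its own inverse.
    C₂ ·ᴹ scaleRows d S₁.D , C₁ ·ᴹ scaleRows d S₂.D , s ,
    scaled-inverse {C₁ = C₁} {S₁.D} {C₂} {S₂.D} d-sign S₁.DC≋1 S₂.CD≋1 ,
    scaled-inverse {C₁ = C₂} {S₂.D} {C₁} {S₁.D} d-sign S₂.DC≋1 S₁.CD≋1 , s-sign , N₂≡
    where
    open ≡-Reasoning
    regroup : ∀ d x s → d * (d * x * s) * s ≡ (d * d) * (s * s) * x
    regroup = solve-∀
    X₂≡ : ∀ l e → S₂.X l e ≡ d l * S₁.X l e * s e
    X₂≡ l e = sym (begin
      d l * S₁.X l e * s e                       ≡⟨ cong (λ z → d l * z * s e) (X₁≡ (∈-allFin e) l) ⟩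
      d l * (d l * S₂.X l e * s e) * s e         ≡⟨ regroup (d l) (S₂.X l e) (s e) ⟩
      (d l * d l) * (s e * s e) * S₂.X l e       ≡⟨ cong₂ (λ x y → x * y * S₂.X l e) (sign-square (d-sign l)) (sign-square (s-sign e)) ⟩
      + 1 * S₂.X l e                             ≡⟨ ℤₚ.*-identityˡ _ ⟩
      S₂.X l e                                   ∎)
    N₂≡ : ∀ i e → N₂ i e ≡ ((C₂ ·ᴹ scaleRows d S₁.D) ·ᴹ N₁) i e * s e
    N₂≡ i e = begin
      N₂ i e                                                   ≡⟨ S₂.factor i e ⟩
      sumℤ (λ l → C₂ i l * S₂.X l e)
        ≡⟨ Σℤ.sum-cong (λ l → trans (cong (C₂ i l *_) (X₂≡ l e)) (sym (ℤₚ.*-assoc (C₂ i l) (d l * S₁.X l e) (s e)))) ⟩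
      sumℤ (λ l → C₂ i l * (d l * S₁.X l e) * s e)             ≡⟨ Σℤ.sum-* (s e) (λ l → C₂ i l * (d l * S₁.X l e)) ⟨
      (C₂ ·ᴹ scaleRows d S₁.X) i e * s e
        ≡⟨ cong (_* s e) (·-congˡ C₂ (≋-sym (scaleRows-· d S₁.D N₁)) i e) ⟩
      (C₂ ·ᴹ (scaleRows d S₁.D ·ᴹ N₁)) i e * s e               ≡⟨ cong (_* s e) (·-assoc C₂ (scaleRows d S₁.D) N₁ i e) ⟨
      ((C₂ ·ᴹ scaleRows d S₁.D) ·ᴹ N₁) i e * s e               ∎

-- Polytopes and polars

choose : ∀ {z} {X : Set} → IsSign z → X → X → X
choose (inj₁ _) x y = x
choose (inj₂ _) x y = y

choose-elim : ∀ {z} {X : Set} (Q : X → Set) (s : IsSign z) {x y} → Q x → Q y → Q (choose s x y)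
choose-elim Q (inj₁ _) qx qy = qx
choose-elim Q (inj₂ _) qx qy = qy

choose-+ : ∀ {z} (s : IsSign z) x y → choose s x y ℚ.+ choose s y x ≡ x ℚ.+ y
choose-+ (inj₁ _) x y = refl
choose-+ (inj₂ _) x y = ℚₚ.+-comm y x

-- A column of [ M ∣ - M ] and its negative trade places when the column changes sign.
choose-signed : ∀ {z} (s : IsSign z) x y w → choose s x y ℚ.* toℚ (w * z) ℚ.+ ℚ.- choose s y x ℚ.* toℚ (w * z)
  ≡ x ℚ.* toℚ w ℚ.+ ℚ.- y ℚ.* toℚ w
choose-signed (inj₁ refl) x y w rewrite ℤₚ.*-identityʳ w = refl
choose-signed (inj₂ refl) x y w = trans (cong (λ q → y ℚ.* q ℚ.+ ℚ.- x ℚ.* q) (toℚ-* w (- (+ 1)))) (swap x y (toℚ w))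
  where
  open +-*-Solver
  swap : ∀ x y w → y ℚ.* (w ℚ.* (ℚ.- 1ℚ)) ℚ.+ ℚ.- x ℚ.* (w ℚ.* (ℚ.- 1ℚ)) ≡ x ℚ.* w ℚ.+ ℚ.- y ℚ.* w
  swap = solve 3 (λ x y w → y :* (w :* (:- con 1ℚ)) :+ (:- x) :* (w :* (:- con 1ℚ)) := x :* w :+ (:- y) :* w) refl

-- The convex weights move along: `ρ` relabels them, and wherever a column changes sign, the weights
-- of the column and of its negative are swapped.
polytope-map : ∀ {r n} {M₁ M₂ : Mat r n} {F : Mat r r} (ρ : Permutation′ n) {t : Fin n → ℤ} → (∀ j → IsSign (t j)) →
  (∀ p j → M₂ p j ≡ (F ·ᴹ M₁) p (ρ ⟨$⟩ʳ j) * t j) → ∀ {x} → Polytope M₁ x → Polytope M₂ (apply F x)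
polytope-map {M₁ = M₁} {M₂} {F} ρ {t} t-sign M₂≡ {x} (lam , mu , lam≥0 , mu≥0 , total , x≡) =
  lam′ , mu′ , (λ j → choose-elim (0ℚ ℚ.≤_) (t-sign j) (lam≥0 _) (mu≥0 _)) ,
  (λ j → choose-elim (0ℚ ℚ.≤_) (t-sign j) (mu≥0 _) (lam≥0 _)) , total′ , image≡
  where
  open ≡-Reasoning
  lam′ = λ j → choose (t-sign j) (lam (ρ ⟨$⟩ʳ j)) (mu (ρ ⟨$⟩ʳ j))
  mu′  = λ j → choose (t-sign j) (mu (ρ ⟨$⟩ʳ j)) (lam (ρ ⟨$⟩ʳ j))
  total′ : sumℚ lam′ ℚ.+ sumℚ mu′ ≡ 1ℚ
  total′ = begin
    sumℚ lam′ ℚ.+ sumℚ mu′                                      ≡⟨ Σℚ.sum-+ lam′ mu′ ⟨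
    sumℚ (λ j → lam′ j ℚ.+ mu′ j)                               ≡⟨ Σℚ.sum-cong (λ j → choose-+ (t-sign j) _ _) ⟩
    sumℚ (λ j → lam (ρ ⟨$⟩ʳ j) ℚ.+ mu (ρ ⟨$⟩ʳ j))               ≡⟨ Σℚ.sum-permute (λ j → lam j ℚ.+ mu j) ρ ⟨
    sumℚ (λ j → lam j ℚ.+ mu j)                                 ≡⟨ Σℚ.sum-+ lam mu ⟩
    sumℚ lam ℚ.+ sumℚ mu                                        ≡⟨ total ⟩
    1ℚ                                                          ∎
  FM = F ·ᴹ M₁
  negmu = λ j → ℚ.- mu j
  image≡ : ∀ p → apply F x p ≡ combo M₂ lam′ p ℚ.+ combo M₂ (λ j → ℚ.- mu′ j) p
  image≡ p = sym (begin
    combo M₂ lam′ p ℚ.+ combo M₂ (λ j → ℚ.- mu′ j) p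
      ≡⟨ Σℚ.sum-+ (λ j → lam′ j ℚ.* toℚ (M₂ p j)) (λ j → ℚ.- mu′ j ℚ.* toℚ (M₂ p j)) ⟨
    sumℚ (λ j → lam′ j ℚ.* toℚ (M₂ p j) ℚ.+ ℚ.- mu′ j ℚ.* toℚ (M₂ p j))
      ≡⟨ Σℚ.sum-cong (λ j → trans (cong (λ z → lam′ j ℚ.* toℚ z ℚ.+ ℚ.- mu′ j ℚ.* toℚ z) (M₂≡ p j))
           (choose-signed (t-sign j) (lam (ρ ⟨$⟩ʳ j)) (mu (ρ ⟨$⟩ʳ j)) (FM p (ρ ⟨$⟩ʳ j)))) ⟩
    sumℚ (λ j → lam (ρ ⟨$⟩ʳ j) ℚ.* toℚ (FM p (ρ ⟨$⟩ʳ j)) ℚ.+ negmu (ρ ⟨$⟩ʳ j) ℚ.* toℚ (FM p (ρ ⟨$⟩ʳ j)))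
      ≡⟨ Σℚ.sum-permute (λ j → lam j ℚ.* toℚ (FM p j) ℚ.+ negmu j ℚ.* toℚ (FM p j)) ρ ⟨
    sumℚ (λ j → lam j ℚ.* toℚ (FM p j) ℚ.+ negmu j ℚ.* toℚ (FM p j))
      ≡⟨ Σℚ.sum-+ (λ j → lam j ℚ.* toℚ (FM p j)) (λ j → negmu j ℚ.* toℚ (FM p j)) ⟩
    combo FM lam p ℚ.+ combo FM negmu p
      ≡⟨ cong₂ ℚ._+_ (combo-· {P = F} {M₁} {FM} (λ _ _ → refl) lam p) (combo-· {P = F} {M₁} {FM} (λ _ _ → refl) negmu p) ⟩
    sumℚ (λ l → toℚ (F p l) ℚ.* combo M₁ lam l) ℚ.+ sumℚ (λ l → toℚ (F p l) ℚ.* combo M₁ negmu l)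
      ≡⟨ Σℚ.sum-+ (λ l → toℚ (F p l) ℚ.* combo M₁ lam l) (λ l → toℚ (F p l) ℚ.* combo M₁ negmu l) ⟨
    sumℚ (λ l → toℚ (F p l) ℚ.* combo M₁ lam l ℚ.+ toℚ (F p l) ℚ.* combo M₁ negmu l)
      ≡⟨ Σℚ.sum-cong (λ l → trans (sym (ℚₚ.*-distribˡ-+ (toℚ (F p l)) (combo M₁ lam l) (combo M₁ negmu l)))
           (cong (toℚ (F p l) ℚ.*_) (sym (x≡ l)))) ⟩
    apply F x p ∎)

apply-inverse : ∀ {r} {F G : Mat r r} → F ·ᴹ G ≋ δ → ∀ x i → apply F (apply G x) i ≡ x i
apply-inverse {F = F} {G} FG≋1 x i = begin
  apply F (apply G x) i
    ≡⟨ Σℚ.sum-assoc (λ l → toℚ (F i l)) (λ l k → toℚ (G l k)) x ⟨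
  sumℚ (λ k → sumℚ (λ l → toℚ (F i l) ℚ.* toℚ (G l k)) ℚ.* x k)
    ≡⟨ Σℚ.sum-cong (λ k → cong (ℚ._* x k) (trans (sym (toℚ-sum-* (F i) (λ l → G l k))) (cong toℚ (FG≋1 i k)))) ⟩
  sumℚ (λ k → toℚ (δ i k) ℚ.* x k)
    ≡⟨ Σℚ.sum-single i (λ k k≢i → trans (cong (λ z → toℚ z ℚ.* x k) (δ-≢ (k≢i ∘ sym))) (ℚₚ.*-zeroˡ (x k))) ⟩
  toℚ (δ i i) ℚ.* x i
    ≡⟨ trans (cong (λ z → toℚ z ℚ.* x i) (δ-refl i)) (ℚₚ.*-identityˡ (x i)) ⟩
  x i ∎
  where open ≡-Reasoning

dot-transpose : ∀ {r} (F : Mat r r) u x → dot (apply (transpose F) u) x ≡ dot u (apply F x)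
dot-transpose F u x = trans
  (Σℚ.sum-cong (λ i → cong (ℚ._* x i) (Σℚ.sum-cong (λ j → ℚₚ.*-comm (toℚ (F j i)) (u j)))))
  (Σℚ.sum-assoc u (λ j i → toℚ (F j i)) x)

dot-cong : ∀ {r} {u v : Vecℚ r} → (∀ i → u i ≡ v i) → ∀ x → dot u x ≡ dot v x
dot-cong u≡v x = Σℚ.sum-cong (λ i → cong (ℚ._* x i) (u≡v i))

transpose-inverse : ∀ {r} {F G : Mat r r} → F ·ᴹ G ≋ δ → transpose G ·ᴹ transpose F ≋ δ
transpose-inverse {F = F} {G} FG≋1 i j = trans (Σℤ.sum-cong (λ l → ℤₚ.*-comm (G l i) (F j l))) (trans (FG≋1 j i) (δ-sym j i))

polytope-resp : ∀ {r n} (M : Mat r n) {x y} → (∀ i → x i ≡ y i) → Polytope M y → Polytope M x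
polytope-resp M x≡y (lam , mu , l , m , t , y≡) = lam , mu , l , m , t , λ i → trans (x≡y i) (y≡ i)

-- Both equalities are formal once `F` and `G` map the regions into each other. Vectors are
-- functions compared pointwise, whence the assumption that `P₂` respects pointwise equality.
module _ {r} {F G : Mat r r} {P₁ P₂ : Region r} (FG≋1 : F ·ᴹ G ≋ δ)
  (resp₂ : ∀ {x y} → (∀ i → x i ≡ y i) → P₂ y → P₂ x)
  (F-maps : ∀ {x} → P₁ x → P₂ (apply F x)) (G-maps : ∀ {x} → P₂ x → P₁ (apply G x)) where

  image-≐ : P₂ ≐ image F P₁
  image-≐ x = mk⇔ (λ x∈P₂ → apply G x , G-maps x∈P₂ , λ i → sym (apply-inverse {F = F} {G} FG≋1 x i))
    (λ { (y , y∈P₁ , x≡) → resp₂ x≡ (F-maps y∈P₁) })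

  -- Moving `F` and `G` across the dot product carries the polars into each other, and the transpose
  -- of `F G = 1` shows that `transpose G` recovers `u` from its preimage.
  polar-≐ : polar P₂ ≐ image (transpose G) (polar P₁)
  polar-≐ u = mk⇔
    (λ u∈ → apply (transpose F) u ,
      (λ x x∈P₁ → subst (ℚ._≤ 1ℚ) (sym (dot-transpose F u x)) (u∈ (apply F x) (F-maps x∈P₁))) ,
      λ i → sym (apply-inverse {F = transpose G} {transpose F} (transpose-inverse {F = F} {G} FG≋1) u i))
    (λ { (v , v∈ , u≡) x x∈P₂ → subst (ℚ._≤ 1ℚ) (sym (trans (dot-cong u≡ x) (dot-transpose G v x)))
      (v∈ (apply G x) (G-maps x∈P₂)) })

equivalent-sym : ∀ {r n} {N₁ N₂ : Mat r n} {F G : Mat r r} {s : Fin n → ℤ} → G ·ᴹ F ≋ δ → (∀ e → IsSign (s e)) →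
  (∀ i e → N₂ i e ≡ (F ·ᴹ N₁) i e * s e) → ∀ i e → N₁ i e ≡ (G ·ᴹ N₂) i e * s e
equivalent-sym {N₁ = N₁} {N₂} {F} {G} {s} GF≋1 s-sign N₂≡ i e = sym (begin
  (G ·ᴹ N₂) i e * s e
    ≡⟨ cong (_* s e) (Σℤ.sum-cong (λ l → trans (cong (G i l *_) (N₂≡ l e)) (sym (ℤₚ.*-assoc (G i l) ((F ·ᴹ N₁) l e) (s e))))) ⟩
  sumℤ (λ l → G i l * (F ·ᴹ N₁) l e * s e) * s e
    ≡⟨ cong (_* s e) (sym (Σℤ.sum-* (s e) (λ l → G i l * (F ·ᴹ N₁) l e))) ⟩
  (G ·ᴹ (F ·ᴹ N₁)) i e * s e * s e
    ≡⟨ cong (λ z → z * s e * s e) (trans (sym (·-assoc G F N₁ i e)) (trans (·-congʳ N₁ GF≋1 i e) (·-identityˡ N₁ i e))) ⟩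
  N₁ i e * s e * s e
    ≡⟨ trans (ℤₚ.*-assoc (N₁ i e) (s e) (s e)) (trans (cong (N₁ i e *_) (sign-square (s-sign e))) (ℤₚ.*-identityʳ (N₁ i e))) ⟩
  N₁ i e ∎)
  where open ≡-Reasoning

-- A column index of `M₂` is taken back to the ground set by the inverse of `σ₂` and on to a column
-- of `M₁` by `σ₁`.
permuted-polytope-map : ∀ {r n} {M₁ M₂ : Mat r n} {F : Mat r r} (σ₁ σ₂ : Permutation′ n) {s : Fin n → ℤ} → (∀ e → IsSign (s e)) →
  (∀ p e → M₂ p (σ₂ ⟨$⟩ʳ e) ≡ (F ·ᴹ cols M₁ (σ₁ ⟨$⟩ʳ_)) p e * s e) → ∀ {x} → Polytope M₁ x → Polytope M₂ (apply F x)
permuted-polytope-map {M₁ = M₁} {M₂} {F} σ₁ σ₂ s-sign eq = polytope-map {M₁ = M₁} {M₂} {F} (Perm.flip σ₂ ∘ₚ σ₁) (λ j → s-sign (σ₂ ⟨$⟩ˡ j))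
  (λ p j → trans (cong (M₂ p) (sym (Perm.inverseʳ σ₂))) (eq p (σ₂ ⟨$⟩ˡ j)))

represents-indep : ∀ {r n} {𝓜 : Matroid n} (M : Mat r n) ((σ , _) : Represents M 𝓜) (S : Subset n) →
  Matroid.Indep 𝓜 S ⇔ ColsIndep (cols M (σ ⟨$⟩ʳ_)) (_∈ˢ S)
represents-indep M (σ , iff) S = Compose.equivalence (iff S) (indep-permute M σ (_∈ˢ S))

theorem3p2 : ∀ (r n : ℕ) → 0 < r → (𝓜 : Matroid n) → HasRank 𝓜 r → Regular 𝓜 r →
    (M₁ M₂ : Mat r n) →
    FullRankWeaklyUnimodular M₁ → Represents M₁ 𝓜 →
    FullRankWeaklyUnimodular M₂ → Represents M₂ 𝓜 →
    Σ (Mat r r) λ F → Σ (Mat r r) λ G → IsInverse F G ×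
    (Polytope M₂ ≐ image F (Polytope M₁)) ×
    (polar (Polytope M₂) ≐ image (transpose G) (polar (Polytope M₁)))
theorem3p2 r n _ 𝓜 ((S , S-indep , refl) , _) _ M₁ M₂ wu₁ rep₁@(σ₁ , _) wu₂ rep₂@(σ₂ , _) = go equivalent
  where
  N₁ = cols M₁ (σ₁ ⟨$⟩ʳ_)
  N₂ = cols M₂ (σ₂ ⟨$⟩ʳ_)
  indep₁ : ∀ T → Matroid.Indep 𝓜 T ⇔ ColsIndep N₁ (_∈ˢ T)
  indep₁ = represents-indep {𝓜 = 𝓜} M₁ rep₁
  indep₂ : ∀ T → Matroid.Indep 𝓜 T ⇔ ColsIndep N₂ (_∈ˢ T)
  indep₂ = represents-indep {𝓜 = 𝓜} M₂ rep₂
  -- Matching `∣ S ∣ ≡ r` with `refl` has made `r` the size of `S`, so the enumeration selects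
  -- exactly `r` columns.
  basis = enumerate S
  c = proj₁ basis
  c-inj = proj₁ (proj₂ basis)
  c∈S = proj₂ (proj₂ basis)
  equivalent : UnimodularlyEquivalent N₁ N₂
  equivalent = unique-representation {N₁ = N₁} {N₂} {c}
    -- Choosing the columns `d` of `N₁` is choosing the columns `σ₁ ⟨$⟩ʳ d l` of `M₁`, so
    -- unimodularity carries over by definition.
    (λ d → weaklyUnimodular⇒unimodular M₁ wu₁ (λ l → σ₁ ⟨$⟩ʳ d l))
    (λ d → weaklyUnimodular⇒unimodular M₂ wu₂ (λ l → σ₂ ⟨$⟩ʳ d l))
    (indep⇒trivialKernel N₁ {_∈ˢ S} c c-inj c∈S (Equivalence.to (indep₁ S) S-indep))
    (indep⇒trivialKernel N₂ {_∈ˢ S} c c-inj c∈S (Equivalence.to (indep₂ S) S-indep))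
    (λ T → Compose.equivalence (Symmetry.equivalence (indep₁ T)) (indep₂ T))
  go : UnimodularlyEquivalent N₁ N₂ → Σ (Mat r r) λ F → Σ (Mat r r) λ G → IsInverse F G ×
    (Polytope M₂ ≐ image F (Polytope M₁)) ×
    (polar (Polytope M₂) ≐ image (transpose G) (polar (Polytope M₁)))
  go (F , G , s , FG≋1 , GF≋1 , s-sign , N₂≡) = F , G ,
    ((λ i j → trans (FG≋1 i j) (sym (identity≡δ i j))) , (λ i j → trans (GF≋1 i j) (sym (identity≡δ i j)))) ,
    image-≐ {F = F} {G} FG≋1 (polytope-resp M₂) F-maps G-maps ,
    polar-≐ {F = F} {G} FG≋1 (polytope-resp M₂) F-maps G-maps
    where
    F-maps : ∀ {x} → Polytope M₁ x → Polytope M₂ (apply F x)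
    F-maps = permuted-polytope-map {M₁ = M₁} {M₂} {F} σ₁ σ₂ s-sign N₂≡
    G-maps : ∀ {x} → Polytope M₂ x → Polytope M₁ (apply G x)
    G-maps = permuted-polytope-map {M₁ = M₂} {M₁} {G} σ₂ σ₁ s-sign
      (equivalent-sym {N₁ = N₁} {N₂} {F} {G} GF≋1 s-sign N₂≡)
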